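{- Let $n\ge 1$ be an integer and let $T$ be a tree. Then the $n$-cube visibility number of $T$ equals its $n$-cube arboricity, and the $n$-cube orthogonal visibility number of $T$ equals its $n$-cube orthogonal arboricity; that is, $$\Upsilon_{h^{(n)}}(T)=h^{(n)}(T)\qquad\text{and}\qquad \Upsilon_{h^{(n)\perp}}(T)=h^{(n)\perp}(T).$$
   Context: All graphs are finite and simple. An $n$-cube is an $n$-dimensional (closed) unit hypercube; $\mathbf e_1,\dots,\mathbf e_n$ denote standard basis vectors. Standard model: the objects are pairwise disjoint axis-aligned unit $n$-cubes in $\mathbb{R}^n$. Two cubes see each other if there is an uninterrupted axis-aligned cylindrical channel of positive diameter (a cylinder parallel to some $\mathbf e_i$, $i\in\{1,\dots,n\}$) joining them, where uninterrupted means that it intersects none of the other cubes of the representation. Orthogonal model: the objects are pairwise disjoint unit $n$-cubes in $\mathbb{R}^{n+1}$ aligned with the first $n$ axes, i.e. sets of the form $\prod_{i=1}^n[a_i,a_i+1]\times\{c\}$. Two cubes see each other if there is a cylindrical channel of positive diameter parallel to $\mathbf e_{n+1}$ joining them that intersects none of the other cubes. An $n$-cube (orthogonal) visibility representation of a graph $G$ assigning each vertex to at most $t$ cubes: each vertex is assigned a nonempty set of at most $t$ cubes (all the cubes of the representation being pairwise disjoint), two distinct vertices are adjacent in $G$ if and only if some cube of one sees some cube of the other, and no two cubes assigned to the same vertex see each other. $h^{(n)}(G)$ (resp. $h^{(n)\perp}(G)$), the $n$-cube visibility number (resp. $n$-cube orthogonal visibility number), is the minimum $t$ for which such a representation exists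 in the standard (resp. orthogonal) model. $G$ is an $n$-cube (orthogonal) visibility graph if it has such a representation with exactly one cube per vertex. An $n$-cube (orthogonal) visibility tree is a tree that is an $n$-cube (orthogonal) visibility graph, and an $n$-cube (orthogonal) visibility forest is a disjoint union of $n$-cube (orthogonal) visibility trees. $\Upsilon_{h^{(n)}}(G)$, the $n$-cube arboricity (resp. $\Upsilon_{h^{(n)\perp}}(G)$, the $n$-cube orthogonal arboricity), is the minimum $k$ such that $G$ is the union of $k$ subgraphs each of which is an $n$-cube visibility forest (resp. $n$-cube orthogonal visibility forest). -}

module Defs where

open import Algebra.Bundles using (CommutativeRing)
import Algebra.Definitions.RawMonoid as RawMonoidSum
open import Algebra.Structures using (IsCommutativeRing)
open import Axiom.ExcludedMiddle using (ExcludedMiddle)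
open import Data.Bool.Base using (if_then_else_)
open import Data.Fin.Base using (Fin; zero; suc; fromℕ; inject₁)
open import Data.Fin.Properties using (_≟_)
open import Data.Fin.Subset using (Subset; _∈_; _∉_; Nonempty)
open import Data.Nat.Base as ℕ using (ℕ; zero; suc)
open import Data.Nat.Induction using (<-rec)
open import Data.Nat.Properties using (≮⇒≥)
open import Data.Product.Base using (Σ; ∃; ∃₂; _×_; _,_; proj₁)
open import Data.Sum.Base using (_⊎_)
open import Data.Unit.Base using (⊤)
open import Data.Vec.Functional using (Vector)
open import Function.Bundles using (_⇔_)
open import Function.Definitions using (Injective)
open import Level using (0ℓ)
open import Relation.Binary.Construct.Closure.ReflexiveTransitive using (Star)
import Relation.Binary.Construct.StrictToNonStrict as StrictToNonStrict
open import Relation.Binary.Core using (Rel)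
open import Relation.Binary.PropositionalEquality using (_≡_; _≢_)
open import Relation.Binary.Structures using (IsStrictTotalOrder)
open import Relation.Nullary.Construct.Add.Supremum using (_⁺; [_]; ⊤⁺)
open import Relation.Nullary.Decidable.Core using (Dec; yes; no; does)
open import Relation.Nullary.Negation.Core using (¬_)

-- The real numbers, characterised up to isomorphism as a Dedekind-complete
-- ordered field.

record Reals : Set₁ where
  infix  8 -_
  infix  4 _≈_ _<_
  infixl 6 _+_
  infixl 7 _*_
  field
    Carrier            : Set
    _≈_ _<_            : Rel Carrier 0ℓ
    _+_ _*_            : Carrier → Carrier → Carrier
    -_                 : Carrier → Carrier
    0# 1#              : Carrier
    isCommutativeRing  : IsCommutativeRing _≈_ _+_ _*_ -_ 0# 1#
    isStrictTotalOrder : IsStrictTotalOrder _≈_ _<_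

  open StrictToNonStrict _≈_ _<_ using (_≤_) public

  UpperBound : (Carrier → Set) → Carrier → Set
  UpperBound P b = ∀ x → P x → x ≤ b

  field
    0<1        : 0# < 1#
    inverse    : ∀ x → ¬ (x ≈ 0#) → ∃ λ y → x * y ≈ 1#
    +-monoˡ-<  : ∀ z {x y} → x < y → x + z < y + z
    *-positive : ∀ {x y} → 0# < x → 0# < y → 0# < x * y
    supremum   : (P : Carrier → Set) → ∃ P → ∃ (UpperBound P) →
                 ∃ λ s → UpperBound P s × (∀ b → UpperBound P b → s ≤ b)

  commutativeRing : CommutativeRing 0ℓ 0ℓ
  commutativeRing = record { isCommutativeRing = isCommutativeRing }

  open CommutativeRing commutativeRing public using (_-_; +-rawMonoid)
  open RawMonoidSum +-rawMonoid public using (sum)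

-- Minima of sets of natural numbers, with min ∅ = ⊤⁺ (that is, ∞).

IsMinimum : (ℕ → Set) → ℕ ⁺ → Set
IsMinimum P [ k ] = P k × (∀ j → P j → k ℕ.≤ j)
IsMinimum P ⊤⁺    = ∀ j → ¬ P j

minimum : ExcludedMiddle 0ℓ → (P : ℕ → Set) → Σ (ℕ ⁺) (IsMinimum P)
minimum em P with em {∃ P}
... | no  ∄k       = ⊤⁺ , λ j p → ∄k (j , p)
... | yes (k , pk) = <-rec (λ k → P k → Σ (ℕ ⁺) (IsMinimum P)) step k pk
  where
  step : ∀ k → (∀ {j} → j ℕ.< k → P j → Σ (ℕ ⁺) (IsMinimum P)) →
         P k → Σ (ℕ ⁺) (IsMinimum P)
  step k rec pk with em {∃ λ j → j ℕ.< k × P j}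
  ... | yes (_ , j<k , pj) = rec j<k pj
  ... | no  ∄j             = [ k ] , pk , λ j pj → ≮⇒≥ λ j<k → ∄j (j , j<k , pj)

min : ExcludedMiddle 0ℓ → (ℕ → Set) → ℕ ⁺
min em P = proj₁ (minimum em P)

-- Finite simple graphs.  The vertex set is a subset of Fin N, so that the
-- subgraphs of a graph are again graphs over the same N.

record Graph (N : ℕ) : Set where
  infix 4 _∼_
  field
    vertices      : Subset N
    neighbourhood : Fin N → Subset N

  _∼_ : Rel (Fin N) 0ℓ
  u ∼ v = v ∈ neighbourhood u

  field
    ∼-sym      : ∀ {u v} → u ∼ v → v ∼ u
    ∼-irrefl   : ∀ {u} → ¬ (u ∼ u)
    ∼-vertices : ∀ {u v} → u ∼ v → u ∈ vertices × v ∈ vertices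

module _ {N : ℕ} where

  open Graph

  Connected : Graph N → Set
  Connected G = Nonempty (vertices G) ×
    (∀ u v → u ∈ vertices G → v ∈ vertices G → Star (_∼_ G) u v)

  record Cycle (G : Graph N) : Set where
    field
      {k}       : ℕ
      vertex    : Fin (3 ℕ.+ k) → Fin N
      injective : Injective _≡_ _≡_ vertex
      step      : ∀ i → _∼_ G (vertex (inject₁ i)) (vertex (suc i))
      close     : _∼_ G (vertex (fromℕ _)) (vertex zero)

  IsTree : Graph N → Set
  IsTree G = Connected G × ¬ Cycle G

  IsUnion : {k : ℕ} → (Fin k → Graph N) → Graph N → Set
  IsUnion H G =
    (∀ v → v ∈ vertices G ⇔ (∃ λ i → v ∈ vertices (H i))) ×
    (∀ u v → _∼_ G u v ⇔ (∃ λ i → _∼_ (H i) u v))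

  VertexDisjoint : {k : ℕ} → (Fin k → Graph N) → Set
  VertexDisjoint H =
    ∀ i j → i ≢ j → ∀ v → v ∈ vertices (H i) → v ∉ vertices (H j)

module _ (R : Reals) where

  open Reals R renaming (Carrier to ℝ)

  Region : ℕ → Set₁
  Region m = Vector ℝ m → Set

  Disjoint : ∀ {m} → Region m → Region m → Set
  Disjoint A B = ∀ p → ¬ (A p × B p)

  infix 4 _⊆ᴿ_
  _⊆ᴿ_ : ∀ {m} → Region m → Region m → Set
  A ⊆ᴿ B = ∀ p → A p → B p

  -- Squared distance between the projections of p and q along the axis.

  dist² : ∀ {m} → Fin m → Vector ℝ m → Vector ℝ m → ℝ
  dist² axis p q =
    sum λ j → if does (j ≟ axis) then 0# else (p j - q j) * (p j - q j)

  -- The diameter is that of the cross-section, a ball of the hyperplane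
  -- orthogonal to the axis.  It is positive iff the ball has two distinct
  -- points.  In ℝ¹ the cross-section is a single point whatever the radius, so
  -- there is no channel at all.

  record Channel {m : ℕ} (axis : Fin m) : Set where
    field
      centre       : Vector ℝ m
      radius       : ℝ
      start finish : ℝ
      0≤radius     : 0# ≤ radius
      start<finish : start < finish

    CrossSection : Region m
    CrossSection p = dist² axis p centre ≤ radius * radius

    field
      positiveDiameter : ∃₂ λ p q → CrossSection p × CrossSection q ×
                         (∃ λ j → j ≢ axis × ¬ (p j ≈ q j))

    Cylinder StartFace FinishFace : Region m
    Cylinder   p = CrossSection p × start ≤ p axis × p axis ≤ finish
    StartFace  p = CrossSection p × p axis ≈ start
    FinishFace p = CrossSection p × p axis ≈ finish

    Joins : Region m → Region m → Set
    Joins A B = (StartFace ⊆ᴿ A × FinishFace ⊆ᴿ B)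
              ⊎ (StartFace ⊆ᴿ B × FinishFace ⊆ᴿ A)

  record Model : Set₁ where
    field
      Cube     : Set
      dim      : ℕ
      region   : Cube → Region dim
      Sightway : Fin dim → Set   -- the axes along which cubes may see each other

  standard : ℕ → Model
  standard n = record
    { Cube     = Vector ℝ n
    ; dim      = n
    ; region   = λ a p → ∀ i → a i ≤ p i × p i ≤ a i + 1#
    ; Sightway = λ _ → ⊤
    }

  orthogonal : ℕ → Model
  orthogonal n = record
    { Cube     = Vector ℝ n × ℝ
    ; dim      = suc n
    ; region   = λ (a , c) p →
                   (∀ i → a i ≤ p (inject₁ i) × p (inject₁ i) ≤ a i + 1#) ×
                   p (fromℕ n) ≈ c
    ; Sightway = λ i → i ≡ fromℕ n
    }

module _ {R : Reals} (M : Model R) {N : ℕ} where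

  open Model M
  open Graph

  -- Visibility between the members x and y of a family of cubes.

  Sees : {I : Set} → (I → Cube) → I → I → Set
  Sees cube x y = ∃ λ axis → Sightway axis × Σ (Channel R axis) λ channel →
    Channel.Joins channel (region (cube x)) (region (cube y)) ×
    (∀ z → z ≢ x → z ≢ y →
       Disjoint R (Channel.Cylinder channel) (region (cube z)))

  -- The vertex v is assigned the cubes cube (v , a) for a : Fin (size v).

  record Representation (G : Graph N) : Set where
    field
      size : Fin N → ℕ

    Index : Set
    Index = Σ (Fin N) λ v → Fin (size v)

    field
      cube     : Index → Cube
      assigned : ∀ v → v ∈ vertices G ⇔ 0 ℕ.< size v
      disjoint : ∀ x y → x ≢ y → Disjoint R (region (cube x)) (region (cube y))
      adjacent : ∀ u v → u ≢ v →
                 _∼_ G u v ⇔ (∃₂ λ a b → Sees cube (u , a) (v , b))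
      unseen   : ∀ v a b → a ≢ b → ¬ Sees cube (v , a) (v , b)

  open Representation

  Representable : Graph N → ℕ → Set
  Representable G t = Σ (Representation G) λ ρ → ∀ v → size ρ v ℕ.≤ t

  IsVisibilityGraph : Graph N → Set
  IsVisibilityGraph G =
    Σ (Representation G) λ ρ → ∀ v → v ∈ vertices G → size ρ v ≡ 1

  IsVisibilityTree : Graph N → Set
  IsVisibilityTree G = IsTree G × IsVisibilityGraph G

  IsVisibilityForest : Graph N → Set
  IsVisibilityForest G = ∃ λ k → Σ (Fin k → Graph N) λ H →
    (∀ i → IsVisibilityTree (H i)) × VertexDisjoint H × IsUnion H G

  ForestDecomposable : Graph N → ℕ → Set
  ForestDecomposable G k = Σ (Fin k → Graph N) λ F →
    (∀ i → IsVisibilityForest (F i)) × IsUnion F G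

  visibilityNumber : ExcludedMiddle 0ℓ → Graph N → ℕ ⁺
  visibilityNumber em G = min em (Representable G)

  arboricity : ExcludedMiddle 0ℓ → Graph N → ℕ ⁺
  arboricity em G = min em (ForestDecomposable G)

{-# OPTIONS --safe #-}

-- Arboricity ≤ visibility number.  For each edge uv of T keep only the shortest
-- sighting between a cube of u and a cube of v, ties being broken by an
-- injective perturbation of the coordinates.  Let x and y be cubes of one
-- component C of the kept sightings, on a common line parallel to an axis.  The
-- cubes met on the line trace a walk in the tree T between their labels, which
-- must cross every edge of the path from x to y in C; its steps are at least as
-- long as the kept sightings, while these change the coordinate by at most their
-- length.  So the walk is that path, and deleting all cubes outside C creates no
-- new visibility: C is a visibility tree.  Kept sightings map injectively to
-- edges of the tree T, so the cubes can be coloured with t colours, constant on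
-- components and injective on the cubes of each vertex; the colour classes are
-- the t forests.
--
-- Visibility number ≤ arboricity.  Translate the representations of all the
-- trees far apart along the diagonal (1,…,1).  A channel has points that agree
-- in some coordinate with both cubes it joins, so the translates neither see nor
-- block each other.

module Submission where

open import Defs
open import Algebra.Bundles using (AbelianGroup; CommutativeRing)
import Algebra.Construct.DirectProduct as DirectProduct
import Algebra.Properties.AbelianGroup as AbelianGroupProperties
import Algebra.Properties.Ring as RingProperties
open import Algebra.Structures using (IsAbelianGroup)
open import Axiom.ExcludedMiddle using (ExcludedMiddle)
open import Data.Bool.Base using (if_then_else_)
open import Data.Empty using (⊥)
open import Data.Fin.Base as Fin using (Fin; zero; suc; fromℕ; fromℕ<; inject₁; inject≤; toℕ)
open import Data.Fin.Permutation.Components using (transpose; transpose-inverse)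
open import Data.Fin.Properties as Fin using (_≟_; +↔⊎; inject≤-injective; toℕ-injective)
open import Data.Fin.Relation.Unary.Top
  using (View; view; ‵fromℕ; ‵inject₁; view-fromℕ; view-inject₁)
open import Data.Fin.Subset using (Subset; _⊃_; _∪_; ⁅_⁆) renaming (_∈_ to _∈ˢ_; _∉_ to _∉ˢ_)
open import Data.Fin.Subset.Induction using (⊃-wellFounded)
open import Data.Fin.Subset.Properties using (x∈⁅x⁆; x∈⁅y⁆⇒x≡y; p⊆p∪q; q⊆p∪q; x∈p∪q⁻)
open import Data.Integer.Base as ℤ using (ℤ)
import Data.Integer.Properties as ℤ
open import Data.List.Base
  using (List; []; _∷_; _++_; map; length; lookup; allFin; cartesianProduct)
import Data.List.Membership.DecPropositional as DecMembership
open import Data.List.Membership.Propositional using (_∈_; lose)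
open import Data.List.Membership.Propositional.Properties
  using (∈-lookup; ∈-map⁺; ∈-++⁺ˡ; ∈-++⁺ʳ; ∈-allFin; ∈-cartesianProduct⁺)
open import Data.List.Relation.Unary.All as All using (All; []; _∷_)
import Data.List.Relation.Unary.All.Properties as All
open import Data.List.Relation.Unary.AllPairs using (AllPairs; []; _∷_)
open import Data.List.Relation.Unary.Any as Any using (Any; here; there)
open import Data.List.Relation.Unary.Any.Properties using (lookup-index)
open import Data.List.Relation.Unary.Unique.Propositional using (Unique)
open import Data.Nat.Base as ℕ using (ℕ; zero; suc; z≤n; s≤s)
import Data.Nat.Properties as ℕ
open import Data.Product.Base using (Σ; ∃; ∃₂; _×_; _,_; proj₁; proj₂; swap)
open import Data.Product.Relation.Binary.Lex.Strict using (×-isStrictTotalOrder)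
open import Data.Sum.Base as Sum using (_⊎_; inj₁; inj₂)
open import Data.Sum.Function.Propositional using (_⊎-↔_)
open import Data.Vec.Base using (tabulate)
open import Data.Vec.Functional using (Vector)
open import Data.Vec.Properties using (lookup⇒[]=; []=⇒lookup; lookup∘tabulate)
open import Data.Vec.Properties.WithK using ([]=-irrelevant)
open import Function.Base using (_∘_)
open import Function.Bundles using (_↔_; _⇔_; mk↔ₛ′; mk⇔; Equivalence; Injection; Inverse)
open import Function.Construct.Composition using (_↔-∘_)
open import Function.Construct.Identity using (↔-id)
open import Function.Definitions using (Injective)
open import Function.Properties.Inverse using (↔⇒↣; ↔-sym)
open import Induction.WellFounded using (Acc; acc)
open import Level using (0ℓ)
open import Relation.Binary.Construct.Closure.ReflexiveTransitive as Star
  using (Star; ε; _◅_; _◅◅_)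
import Relation.Binary.Construct.StrictToNonStrict as StrictToNonStrict
open import Relation.Binary.Core using (Rel)
open import Relation.Binary.Definitions using (DecidableEquality; tri<; tri≈; tri>)
open import Relation.Binary.PropositionalEquality
  using (_≡_; _≢_; refl; sym; trans; cong; subst; subst₂)
open import Relation.Binary.Structures using (IsStrictTotalOrder)
open import Relation.Nullary.Construct.Add.Supremum using ([_]; ⊤⁺)
open import Relation.Nullary.Decidable using (dec-true)
open import Relation.Nullary.Decidable.Core using (Dec; yes; no; does)
open import Relation.Nullary.Negation.Core using (¬_; contradiction)

-- Ordered abelian groups

-- The obstacle is that deleting cubes can let the remaining ones see each other through the gap, so
-- a component of the kept sightings need not represent itself; keeping the shortest sightings
-- prevents this. The length of a sighting is the difference of the lower coordinates of its cubes
-- along the axis of sight. By disjointness it exceeds the common extent `width` of the cubes along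
-- such an axis, whereas along any other axis of sight the two cubes overlap in projection and their
-- lower coordinates differ by at most `width`. Hence a kept sighting, measured along any axis of
-- sight, changes the coordinate by no more than any sighting between the same two vertices, and one
-- argument serves both models. The lines in question are chosen generic, away from all faces
-- parallel to them: only then do consecutive cubes on a line see each other through a channel of
-- positive diameter. The perturbation is what lets a tight inequality identify cubes and not merely
-- their coordinates.

record OrderedGroup : Set₁ where
  infix  8 -_
  infix  4 _≈_ _<_
  infixl 6 _+_
  field
    Carrier            : Set
    _≈_ _<_            : Rel Carrier 0ℓ
    _+_                : Carrier → Carrier → Carrier
    0#                 : Carrier
    -_                 : Carrier → Carrier
    isAbelianGroup     : IsAbelianGroup _≈_ _+_ 0# -_
    isStrictTotalOrder : IsStrictTotalOrder _≈_ _<_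
    +-monoˡ-<          : ∀ z {x y} → x < y → x + z < y + z

  open StrictToNonStrict _≈_ _<_ using (_≤_) public

  abelianGroup : AbelianGroup 0ℓ 0ℓ
  abelianGroup = record { isAbelianGroup = isAbelianGroup }

  open AbelianGroup abelianGroup public
    using (_-_)
    renaming
      ( refl to ≈-refl; reflexive to ≈-reflexive; sym to ≈-sym; trans to ≈-trans
      ; ∙-cong to +-cong; ∙-congˡ to +-congˡ; ∙-congʳ to +-congʳ
      ; comm to +-comm; assoc to +-assoc
      ; identityˡ to +-identityˡ; identityʳ to +-identityʳ
      ; inverseˡ to -‿inverseˡ; inverseʳ to -‿inverseʳ; ⁻¹-cong to -‿cong
      )
  open AbelianGroupProperties abelianGroup public
    using () renaming (⁻¹-∙-comm to -‿+-comm; ⁻¹-involutive to -‿involutive)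

  open IsStrictTotalOrder isStrictTotalOrder public
    using (compare; irrefl; <-resp-≈)
    renaming (trans to <-trans)

  private
    eq = IsStrictTotalOrder.isEquivalence isStrictTotalOrder
    module S = StrictToNonStrict _≈_ _<_

  ≤-refl : ∀ {x} → x ≤ x
  ≤-refl = inj₂ ≈-refl

  ≤-trans : ∀ {x y z} → x ≤ y → y ≤ z → x ≤ z
  ≤-trans = S.trans eq <-resp-≈ <-trans

  <-≤-trans : ∀ {x y z} → x < y → y ≤ z → x < z
  <-≤-trans = S.<-≤-trans <-trans (proj₁ <-resp-≈)

  ≤-<-trans : ∀ {x y z} → x ≤ y → y < z → x < z
  ≤-<-trans = S.≤-<-trans ≈-sym <-trans (proj₂ <-resp-≈)

  ≤-antisym : ∀ {x y} → x ≤ y → y ≤ x → x ≈ y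
  ≤-antisym = S.antisym eq <-trans irrefl

  ≤-total : ∀ x y → x ≤ y ⊎ y ≤ x
  ≤-total = S.total compare

  <⇒≱ : ∀ {x y} → x < y → ¬ (y ≤ x)
  <⇒≱ x<y y≤x = irrefl ≈-refl (<-≤-trans x<y y≤x)

  <-≤-connex : ∀ x y → x < y ⊎ y ≤ x
  <-≤-connex x y with compare x y
  ... | tri< x<y _ _ = inj₁ x<y
  ... | tri≈ _ x≈y _ = inj₂ (inj₂ (≈-sym x≈y))
  ... | tri> _ _ y<x = inj₂ (inj₁ y<x)

  ≤-respˡ-≈ : ∀ {x y z} → x ≈ y → x ≤ z → y ≤ z
  ≤-respˡ-≈ x≈y = ≤-trans (inj₂ (≈-sym x≈y))

  ≤-respʳ-≈ : ∀ {x y z} → x ≈ y → z ≤ x → z ≤ y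
  ≤-respʳ-≈ x≈y z≤x = ≤-trans z≤x (inj₂ x≈y)

  <-respˡ-≈ : ∀ {x y z} → x ≈ y → x < z → y < z
  <-respˡ-≈ = proj₂ <-resp-≈

  <-respʳ-≈ : ∀ {x y z} → x ≈ y → z < x → z < y
  <-respʳ-≈ = proj₁ <-resp-≈

  +-monoʳ-< : ∀ z {x y} → x < y → z + x < z + y
  +-monoʳ-< z x<y = <-respˡ-≈ (+-comm _ z) (<-respʳ-≈ (+-comm _ z) (+-monoˡ-< z x<y))

  +-monoˡ-≤ : ∀ z {x y} → x ≤ y → x + z ≤ y + z
  +-monoˡ-≤ z (inj₁ x<y) = inj₁ (+-monoˡ-< z x<y)
  +-monoˡ-≤ z (inj₂ x≈y) = inj₂ (+-congʳ x≈y)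

  +-monoʳ-≤ : ∀ z {x y} → x ≤ y → z + x ≤ z + y
  +-monoʳ-≤ z (inj₁ x<y) = inj₁ (+-monoʳ-< z x<y)
  +-monoʳ-≤ z (inj₂ x≈y) = inj₂ (+-congˡ x≈y)

  +-mono-≤ : ∀ {x y u v} → x ≤ y → u ≤ v → x + u ≤ y + v
  +-mono-≤ x≤y u≤v = ≤-trans (+-monoˡ-≤ _ x≤y) (+-monoʳ-≤ _ u≤v)

  x+y-y≈x : ∀ x y → x + y - y ≈ x
  x+y-y≈x x y = ≈-trans (+-assoc x y (- y)) (≈-trans (+-congˡ (-‿inverseʳ y)) (+-identityʳ x))

  x-y+y≈x : ∀ x y → x - y + y ≈ x
  x-y+y≈x x y = ≈-trans (+-assoc x (- y) y) (≈-trans (+-congˡ (-‿inverseˡ y)) (+-identityʳ x))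

  +-cancelʳ-≤ : ∀ z {x y} → x + z ≤ y + z → x ≤ y
  +-cancelʳ-≤ z p = ≤-respˡ-≈ (x+y-y≈x _ z) (≤-respʳ-≈ (x+y-y≈x _ z) (+-monoˡ-≤ (- z) p))

  +-cancelʳ-< : ∀ z {x y} → x + z < y + z → x < y
  +-cancelʳ-< z p = <-respˡ-≈ (x+y-y≈x _ z) (<-respʳ-≈ (x+y-y≈x _ z) (+-monoˡ-< (- z) p))

  x≤y+z⇒x-y≤z : ∀ {x y z} → x ≤ y + z → x - y ≤ z
  x≤y+z⇒x-y≤z {x} {y} {z} p = +-cancelʳ-≤ y
    (≤-respˡ-≈ (≈-sym (x-y+y≈x x y)) (≤-respʳ-≈ (+-comm y z) p))

  y+z<x⇒z<x-y : ∀ {x y z} → y + z < x → z < x - y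
  y+z<x⇒z<x-y {x} {y} {z} p = +-cancelʳ-< y
    (<-respʳ-≈ (≈-sym (x-y+y≈x x y)) (<-respˡ-≈ (+-comm y z) p))

  x<y⇒0<y-x : ∀ {x y} → x < y → 0# < y - x
  x<y⇒0<y-x {x} {y} x<y = <-respˡ-≈ (-‿inverseʳ x) (+-monoˡ-< (- x) x<y)

  x-y+z-x≈z-y : ∀ x y z → (x - y) + (z - x) ≈ z - y
  x-y+z-x≈z-y x y z = ≈-trans (+-comm _ _) (≈-trans (≈-sym (+-assoc _ x (- y))) (+-congʳ (x-y+y≈x z x)))

  neg-mono-< : ∀ {x y} → x < y → - y < - x
  neg-mono-< {x} {y} x<y = +-cancelʳ-< y (+-cancelʳ-< x
    (<-respˡ-≈ (≈-sym (≈-trans (+-congʳ (-‿inverseˡ y)) (+-identityˡ x)))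
    (<-respʳ-≈ (≈-sym (≈-trans (+-assoc _ y x) (≈-trans (+-congˡ (+-comm y x))
      (≈-trans (≈-sym (+-assoc _ x y)) (≈-trans (+-congʳ (-‿inverseˡ x)) (+-identityˡ y)))))) x<y)))

ℤ-orderedGroup : OrderedGroup
ℤ-orderedGroup = record
  { isAbelianGroup     = ℤ.+-0-isAbelianGroup
  ; isStrictTotalOrder = ℤ.<-isStrictTotalOrder
  ; +-monoˡ-<          = ℤ.+-monoˡ-<
  }

-- The second group is infinitesimal against the first: `(a , b)` is `a` perturbed by `b`. A strict
-- inequality between first components decides a comparison whatever the perturbations are, and
-- perturbed values can still be added and cancelled.
lexicographic : OrderedGroup → OrderedGroup → OrderedGroup
lexicographic A B = record
  { isAbelianGroup     = AbelianGroup.isAbelianGroup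
      (DirectProduct.abelianGroup A.abelianGroup B.abelianGroup)
  ; isStrictTotalOrder = ×-isStrictTotalOrder A.isStrictTotalOrder B.isStrictTotalOrder
  ; +-monoˡ-<          = λ where
      (a , _) (inj₁ x<y)          → inj₁ (A.+-monoˡ-< a x<y)
      (a , b) (inj₂ (x≈y , u<v)) → inj₂ (A.+-congʳ x≈y , B.+-monoˡ-< b u<v)
  }
  where
  module A = OrderedGroup A
  module B = OrderedGroup B

-- Paths and cycles

module _ {A : Set} (R : A → A → Set) where

  -- The list leaves out the starting point; `x ∷ ys` lists all the points, and on that list
  -- simplicity is stated and cycles are read off.
  data Path : A → List A → A → Set where
    []  : ∀ {x} → Path x [] x
    _∷_ : ∀ {x y ys z} → R x y → Path y ys z → Path x (y ∷ ys) z

  SimplePath : A → A → Set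
  SimplePath x y = ∃ λ ys → Path x ys y × Unique (x ∷ ys)

module _ {A : Set} (_≟ᴬ_ : DecidableEquality A) {R : A → A → Set} where

  open DecMembership _≟ᴬ_ using (_∈?_)

  Path-suffix : ∀ {a as x y} → Path R a as y → Unique (a ∷ as) → x ∈ a ∷ as → SimplePath R x y
  Path-suffix p       u       (here refl)  = _ , p , u
  Path-suffix (_ ∷ p) (_ ∷ u) (there x∈as) = Path-suffix p u x∈as

  -- When the new starting point already lies on the simple path built from the rest, the suffix
  -- from that occurrence is simple and starts in the right place.
  loopErasure : ∀ {x y} → Star R x y → SimplePath R x y
  loopErasure ε = [] , [] , [] ∷ []
  loopErasure {x} (r ◅ s) with loopErasure s
  ... | ys , p , u with x ∈? _ ∷ ys
  ...   | yes x∈ = Path-suffix p u x∈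
  ...   | no  x∉ = _ , r ∷ p , All.¬Any⇒All¬ _ x∉ ∷ u

AllPairs-lookup : {A : Set} {R : A → A → Set} → (∀ {x y} → R x y → R y x) →
                  ∀ {xs} → AllPairs R xs → ∀ {i j} → i ≢ j → R (lookup xs i) (lookup xs j)
AllPairs-lookup R-sym (_ ∷ _)  {zero}  {zero}  i≢j = contradiction refl i≢j
AllPairs-lookup R-sym (rs ∷ _) {zero}  {suc j} _   = All.lookup rs (∈-lookup j)
AllPairs-lookup R-sym (rs ∷ _) {suc i} {zero}  _   = R-sym (All.lookup rs (∈-lookup i))
AllPairs-lookup R-sym (_ ∷ ps) {suc i} {suc j} i≢j = AllPairs-lookup R-sym ps (i≢j ∘ cong suc)

Unique⇒lookup-injective : {A : Set} {xs : List A} → Unique xs → Injective _≡_ _≡_ (lookup xs)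
Unique⇒lookup-injective u {i} {j} eq with i ≟ j
... | yes i≡j = i≡j
... | no  i≢j = contradiction eq (AllPairs-lookup (λ x≢y → x≢y ∘ sym) u i≢j)

module _ {A : Set} {R : A → A → Set} where

  Path-step : ∀ {x ys z} → Path R x ys z → ∀ i →
              R (lookup (x ∷ ys) (inject₁ i)) (lookup (x ∷ ys) (suc i))
  Path-step (r ∷ p) zero    = r
  Path-step (r ∷ p) (suc i) = Path-step p i

  Path-last : ∀ {x ys z} → Path R x ys z → lookup (x ∷ ys) (fromℕ (length ys)) ≡ z
  Path-last []      = refl
  Path-last (_ ∷ p) = Path-last p

  Path-target : ∀ {P : A → Set} → (∀ {x y} → R x y → P y) → ∀ {x ys z} → Path R x ys z → All P ys
  Path-target f []      = []
  Path-target f (r ∷ p) = f r ∷ Path-target f p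

  Path-map : {R′ : A → A → Set} → (∀ {x y} → R x y → R′ x y) → ∀ {x ys z} → Path R x ys z → Path R′ x ys z
  Path-map f []      = []
  Path-map f (r ∷ p) = f r ∷ Path-map f p

module _ {N : ℕ} (G : Graph N) where
  open Graph G

  AvoidingStep : Fin N → Fin N → Fin N → Set
  AvoidingStep v x y = x ∼ y × x ≢ v × y ≢ v

  -- Erasing loops keeps the walk away from `v`, so `v` can be put in front. Since `x` and `y`
  -- differ, the erased walk has at least two points, which gives the three that a cycle needs.
  detour⇒cycle : ∀ {v x y} → v ∼ x → v ∼ y → x ≢ y → Star (AvoidingStep v) x y → Cycle G
  detour⇒cycle {v} {x} {y} v∼x v∼y x≢y s with loopErasure _≟_ s
  ... | []      , []    , _ = contradiction refl x≢y
  ... | z ∷ zs , p , u = record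
    { vertex    = lookup (v ∷ x ∷ z ∷ zs)
    ; injective = Unique⇒lookup-injective
        ((v≢x ∷ All.map (λ z≢v v≡z → z≢v (sym v≡z)) (Path-target (λ (_ , _ , y≢v) → y≢v) p)) ∷ u)
    ; step      = λ where
        zero    → v∼x
        (suc i) → Path-step (Path-map proj₁ p) i
    ; close     = subst (_∼ v) (sym (Path-last p)) (∼-sym v∼y)
    }
    where
    v≢x : v ≢ x
    v≢x refl = ∼-irrefl v∼x

  -- A vertex of a forest has at most one neighbour in each component left by its removal. This
  -- fixes the attachment of a new vertex in the colouring and the landing label of a crossing in
  -- the ascent.
  acyclic⇒unique-neighbour : ¬ Cycle G → ∀ {v x y} → v ∼ x → v ∼ y →
                             Star (AvoidingStep v) x y → x ≡ y
  acyclic⇒unique-neighbour acyclic {x = x} {y} v∼x v∼y s with x ≟ y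
  ... | yes x≡y = x≡y
  ... | no  x≢y = contradiction (detour⇒cycle v∼x v∼y x≢y s) acyclic

-- Colouring the cubes of a tree

transpose-matchˡ : ∀ {n} (i j : Fin n) → transpose i j i ≡ j
transpose-matchˡ i j rewrite dec-true (i ≟ i) refl = refl

transpose-injective : ∀ {n} (i j : Fin n) → Injective _≡_ _≡_ (transpose i j)
transpose-injective i j {x} {y} eq = trans (sym (transpose-inverse j i))
  (trans (cong (transpose j i) eq) (transpose-inverse j i))

module Colouring
  (em : ExcludedMiddle 0ℓ) {N : ℕ} (T : Graph N) (tree : IsTree T)
  (size : Fin N → ℕ) (t : ℕ) (size≤t : ∀ v → size v ℕ.≤ t)
  (E : Σ (Fin N) (Fin ∘ size) → Σ (Fin N) (Fin ∘ size) → Set)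
  (E-adjacent : ∀ {x y} → E x y → Graph._∼_ T (proj₁ x) (proj₁ y))
  (E-sym : ∀ {x y} → E x y → E y x)
  (E-unique : ∀ {u v a b a′ b′} → E (u , a) (v , b) → E (u , a′) (v , b′) → a ≡ a′ × b ≡ b′)
  where

  open Graph T

  Colour : Set
  Colour = ∀ v → Fin (size v) → Fin t

  -- Injectivity is asked at every vertex, also outside `S`, so that a vertex joining `S` brings an
  -- injective colouring whose values need only be permuted.
  Proper : Subset N → Colour → Set
  Proper S col = (∀ v → Injective _≡_ _≡_ (col v)) ×
    (∀ {u v a b} → u ∈ˢ S → v ∈ˢ S → E (u , a) (v , b) → col u a ≡ col v b)

  Inside : Subset N → Fin N → Fin N → Set
  Inside S u v = u ∼ v × u ∈ˢ S × v ∈ˢ S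

  InnerConnected : Subset N → Set
  InnerConnected S = ∀ {u v} → u ∈ˢ S → v ∈ˢ S → Star (Inside S) u v

  -- By acyclicity `u` is the only neighbour of `v` in the connected set `S`, so the edge from `u`
  -- to `v` is the only source of new constraints.
  module Extend (S : Subset N) (connected : InnerConnected S) {u v : Fin N}
    (u∈S : u ∈ˢ S) (v∉S : v ∉ˢ S) (u∼v : u ∼ v) where

    S⁺ : Subset N
    S⁺ = S ∪ ⁅ v ⁆

    S⊆S⁺ : ∀ {w} → w ∈ˢ S → w ∈ˢ S⁺
    S⊆S⁺ = p⊆p∪q ⁅ v ⁆

    v∈S⁺ : v ∈ˢ S⁺
    v∈S⁺ = q⊆p∪q S ⁅ v ⁆ (x∈⁅x⁆ v)

    split : ∀ {w} → w ∈ˢ S⁺ → w ∈ˢ S ⊎ w ≡ v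
    split w∈ with x∈p∪q⁻ S ⁅ v ⁆ w∈
    ... | inj₁ w∈S = inj₁ w∈S
    ... | inj₂ w∈v = inj₂ (x∈⁅y⁆⇒x≡y v w∈v)

    ∈S⇒≢v : ∀ {w} → w ∈ˢ S → w ≢ v
    ∈S⇒≢v w∈S refl = v∉S w∈S

    unique : ∀ {w} → w ∈ˢ S → v ∼ w → w ≡ u
    unique w∈S v∼w = acyclic⇒unique-neighbour T (proj₂ tree) v∼w (∼-sym u∼v)
      (Star.map (λ (x∼y , x∈ , y∈) → x∼y , ∈S⇒≢v x∈ , ∈S⇒≢v y∈) (connected w∈S u∈S))

    S⊃ : S⁺ ⊃ S
    S⊃ = S⊆S⁺ , v , v∈S⁺ , v∉S

    enlarge : ∀ {x y} → Star (Inside S) x y → Star (Inside S⁺) x y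
    enlarge = Star.map (λ (x∼y , x∈ , y∈) → x∼y , S⊆S⁺ x∈ , S⊆S⁺ y∈)

    connected⁺ : InnerConnected S⁺
    connected⁺ x∈ y∈ with split x∈ | split y∈
    ... | inj₁ x∈S  | inj₁ y∈S  = enlarge (connected x∈S y∈S)
    ... | inj₁ x∈S  | inj₂ refl = enlarge (connected x∈S u∈S) ◅◅ (u∼v , S⊆S⁺ u∈S , v∈S⁺) ◅ ε
    ... | inj₂ refl | inj₁ y∈S  = (∼-sym u∼v , v∈S⁺ , S⊆S⁺ u∈S) ◅ enlarge (connected u∈S y∈S)
    ... | inj₂ refl | inj₂ refl = ε

    module _ (col : Colour) (proper : Proper S col) where

      -- By `E-unique` at most one pair of cubes of `u` and `v` is joined by `E`. Transposing two
      -- colours on `v` makes this pair agree, keeps injectivity on `v` and touches no vertex of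
      -- `S`.
      recoloured : Dec (∃₂ λ a b → E (u , a) (v , b)) → Fin (size v) → Fin t
      recoloured (yes (a , b , _)) = transpose (col v b) (col u a) ∘ col v
      recoloured (no  _)           = col v

      recoloured-injective : ∀ d → Injective _≡_ _≡_ (recoloured d)
      recoloured-injective (yes _) = proj₁ proper v ∘ transpose-injective _ _
      recoloured-injective (no  _) = proj₁ proper v

      recoloured-matches : ∀ d {a b} → E (u , a) (v , b) → recoloured d b ≡ col u a
      recoloured-matches (no ∄e)            e = contradiction (_ , _ , e) ∄e
      recoloured-matches (yes (a , b , e′)) e with E-unique e′ e
      ... | refl , refl = transpose-matchˡ (col v b) (col u a)

      col⁺ : Colour
      col⁺ w with w ≟ v
      ... | yes refl = recoloured em
      ... | no  _    = col w

      col⁺-v : ∀ b → col⁺ v b ≡ recoloured em b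
      col⁺-v b with v ≟ v
      ... | yes refl = refl
      ... | no  v≢v  = contradiction refl v≢v

      col⁺-S : ∀ {w} → w ∈ˢ S → ∀ a → col⁺ w a ≡ col w a
      col⁺-S {w} w∈S a with w ≟ v
      ... | yes refl = contradiction w∈S v∉S
      ... | no  _    = refl

      col⁺-injective : ∀ w → Injective _≡_ _≡_ (col⁺ w)
      col⁺-injective w with w ≟ v
      ... | yes refl = recoloured-injective em
      ... | no  _    = proj₁ proper w

      new : ∀ {w a b} → w ∈ˢ S → E (w , a) (v , b) → col⁺ w a ≡ col⁺ v b
      new {b = b} w∈S e with unique w∈S (∼-sym (E-adjacent e))
      ... | refl = trans (col⁺-S w∈S _) (sym (trans (col⁺-v b) (recoloured-matches em e)))

      proper⁺ : Proper S⁺ col⁺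
      proper⁺ = col⁺-injective , λ x∈ y∈ e → match (split x∈) (split y∈) e
        where
        match : ∀ {x y a b} → x ∈ˢ S ⊎ x ≡ v → y ∈ˢ S ⊎ y ≡ v → E (x , a) (y , b) → col⁺ x a ≡ col⁺ y b
        match (inj₁ x∈S)  (inj₁ y∈S)  e =
          trans (col⁺-S x∈S _) (trans (proj₂ proper x∈S y∈S e) (sym (col⁺-S y∈S _)))
        match (inj₁ x∈S)  (inj₂ refl) e = new x∈S e
        match (inj₂ refl) (inj₁ y∈S)  e = sym (new y∈S (E-sym e))
        match (inj₂ refl) (inj₂ refl) e = contradiction (E-adjacent e) ∼-irrefl

  grow : ∀ {r} S → Acc _⊃_ S → r ∈ˢ S → InnerConnected S → ∃ (Proper S) →
         ∃ λ S′ → ∃ (Proper S′) × r ∈ˢ S′ × (∀ {u v} → u ∈ˢ S′ → u ∼ v → v ∈ˢ S′)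
  grow S (acc rec) r∈S connected (col , proper)
    with em {∃₂ λ u v → u ∈ˢ S × v ∉ˢ S × u ∼ v}
  ... | yes (u , v , u∈S , v∉S , u∼v) =
    grow X.S⁺ (rec X.S⊃) (X.S⊆S⁺ r∈S) X.connected⁺ (X.col⁺ col proper , X.proper⁺ col proper)
    where module X = Extend S connected u∈S v∉S u∼v
  -- No edge of `T` leaves `S` any more, so connectedness of `T` will put every end of an `E`-edge
  -- into `S`.
  ... | no maximal = S , (col , proper) , r∈S , closed
    where
    closed : ∀ {u v} → u ∈ˢ S → u ∼ v → v ∈ˢ S
    closed {v = v} u∈S u∼v with em {v ∈ˢ S}
    ... | yes v∈S = v∈S
    ... | no  v∉S = contradiction (_ , _ , u∈S , v∉S , u∼v) maximal

  Colouring : Set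
  Colouring = Σ Colour λ col → (∀ v → Injective _≡_ _≡_ (col v)) ×
    (∀ {u v a b} → E (u , a) (v , b) → col u a ≡ col v b)

  colouring : Colouring
  colouring = finish (grow ⁅ root ⁆ (⊃-wellFounded ⁅ root ⁆) (x∈⁅x⁆ root) connected₀
    ((λ v a → inject≤ a (size≤t v)) , (λ v → inject≤-injective _ _ _ _) , proper₀))
    where
    root : Fin N
    root = proj₁ (proj₁ (proj₁ tree))

    root∈T : root ∈ˢ vertices
    root∈T = proj₂ (proj₁ (proj₁ tree))

    connected₀ : InnerConnected ⁅ root ⁆
    connected₀ x∈ y∈ with refl ← x∈⁅y⁆⇒x≡y root x∈ | refl ← x∈⁅y⁆⇒x≡y root y∈ = ε

    proper₀ : ∀ {u v a b} → u ∈ˢ ⁅ root ⁆ → v ∈ˢ ⁅ root ⁆ → E (u , a) (v , b) →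
              inject≤ a (size≤t u) ≡ inject≤ b (size≤t v)
    proper₀ x∈ y∈ e with refl ← x∈⁅y⁆⇒x≡y root x∈ | refl ← x∈⁅y⁆⇒x≡y root y∈ =
      contradiction (E-adjacent e) ∼-irrefl

    finish : (∃ λ S → ∃ (Proper S) × root ∈ˢ S × (∀ {u v} → u ∈ˢ S → u ∼ v → v ∈ˢ S)) → Colouring
    finish (S , (col , injective , proper) , root∈S , closed) =
      col , injective , λ e → proper (reached e) (closed (reached e) (E-adjacent e)) e
      where
      follow : ∀ {x y} → Star _∼_ x y → x ∈ˢ S → y ∈ˢ S
      follow ε        x∈S = x∈S
      follow (e ◅ es) x∈S = follow es (closed x∈S e)

      reached : ∀ {u v a b} → E (u , a) (v , b) → u ∈ˢ S
      reached e = follow (proj₂ (proj₁ tree) _ _ root∈T (proj₁ (∼-vertices (E-adjacent e)))) root∈S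

-- Ascending walks

-- The combinatorial core, stated for one axis: `height` is the perturbed coordinate along it and
-- `Up` a step of the walk on a line parallel to it. An `E`-edge may come from a sighting along
-- another axis; only its signed rise along this one enters, through `E-steepest`.
module Ascent
  {N : ℕ} (T : Graph N) (acyclic : ¬ Cycle T)
  {I : Set} (_≟ᴵ_ : DecidableEquality I) (label : I → Fin N)
  (Λ : OrderedGroup) (height : I → OrderedGroup.Carrier Λ)
  (height-injective : ∀ {x y} → OrderedGroup._≈_ Λ (height x) (height y) → x ≡ y)
  (Up E : I → I → Set)
  (Up-adjacent : ∀ {x y} → Up x y → Graph._∼_ T (label x) (label y))
  (Up-mono : ∀ {x y} → Up x y → OrderedGroup._<_ Λ (height x) (height y))
  (E-adjacent : ∀ {x y} → E x y → Graph._∼_ T (label x) (label y))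
  (E-steepest : ∀ {x y z z′} → E x y → Up z z′ → label x ≡ label z → label y ≡ label z′ →
    OrderedGroup._≤_ Λ (OrderedGroup._-_ Λ (height y) (height x))
                       (OrderedGroup._-_ Λ (height z′) (height z)))
  (E-separates : ∀ {x y} → Star E x y → label x ≡ label y → x ≡ y)
  where

  open Graph T
  open OrderedGroup Λ

  Rise : I → I → Carrier
  Rise x y = height y - height x

  Rise-+ : ∀ x y z → Rise x y + Rise y z ≈ Rise x z
  Rise-+ x y z = x-y+z-x≈z-y (height y) (height x) (height z)

  Rise-monoˡ : ∀ {x z} y → height x ≤ height z → Rise z y ≤ Rise x y
  Rise-monoˡ y (inj₁ x<z) = inj₁ (+-monoʳ-< (height y) (neg-mono-< x<z))
  Rise-monoˡ y (inj₂ x≈z) = inj₂ (+-congˡ (-‿cong (≈-sym x≈z)))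

  Rise-cancelˡ : ∀ {x z} y → Rise z y ≤ Rise x y → height x ≤ height z
  Rise-cancelˡ {x} {z} y p with <-≤-connex (height z) (height x)
  ... | inj₂ x≤z = x≤z
  ... | inj₁ z<x = contradiction p (<⇒≱ (+-monoʳ-< (height y) (neg-mono-< z<x)))

  Rise-cancelʳ : ∀ x {y z} → Rise x y ≤ Rise x z → height y ≤ height z
  Rise-cancelʳ x = +-cancelʳ-≤ (- height x)

  ascending : ∀ {x y} → Star Up x y → height x ≤ height y
  ascending ε        = ≤-refl
  ascending (s ◅ ss) = ≤-trans (inj₁ (Up-mono s)) (ascending ss)

  module _ (p : Fin N) where

    AvoidingUp : I → I → Set
    AvoidingUp x y = Up x y × label x ≢ p × label y ≢ p

    -- After its last visit to `p` the walk stays in one component of `T` minus `p`, that of its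
    -- end. This determines the label reached by the step that leaves `p`.
    lastVisit : ∀ {x y} → Star Up x y → label y ≢ p →
                Star AvoidingUp x y ⊎
                ∃₂ λ z z′ → Star Up x z × label z ≡ p × Up z z′ × Star AvoidingUp z′ y
    lastVisit ε _ = inj₁ ε
    lastVisit {x} (_◅_ {j = x′} s ss) y≢p with lastVisit ss y≢p
    ... | inj₂ (_ , _ , zs , rest) = inj₂ (_ , _ , s ◅ zs , rest)
    ... | inj₁ avoiding with label x ≟ p
    ...   | yes x≡p = inj₂ (_ , _ , ε , x≡p , s , avoiding)
    ...   | no  x≢p with avoiding
    ...     | ε                     = inj₁ ((s , x≢p , y≢p) ◅ ε)
    ...     | (a@(_ , x′≢p , _) ◅ as) = inj₁ ((s , x≢p , x′≢p) ◅ a ◅ as)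

    avoidingWalk : ∀ {x y} → Star AvoidingUp x y → Star (AvoidingStep T p) (label x) (label y)
    avoidingWalk = Star.gmap label (λ (s , x≢p , y≢p) → Up-adjacent s , x≢p , y≢p)

    avoidingPath : ∀ {x ys y} → Path E x ys y → label x ≢ p → All (λ z → label z ≢ p) ys →
                   Star (AvoidingStep T p) (label y) (label x)
    avoidingPath []       _   []           = ε
    avoidingPath (e ∷ es) x≢p (y≢p ∷ ys≢p) =
      avoidingPath es y≢p ys≢p ◅◅ (∼-sym (E-adjacent e) , y≢p , x≢p) ◅ ε

  All-last : ∀ {P : I → Set} {x ys y} → Path E x ys y → P x → All P ys → P y
  All-last []       px []         = px
  All-last (_ ∷ es) _  (py ∷ pys) = All-last es py pys

  LabelSimple : List I → Set
  LabelSimple = AllPairs (λ x y → label y ≢ label x)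

  Path-reachable : ∀ {x ys y} → Path E x ys y → All (Star E x) ys
  Path-reachable []       = []
  Path-reachable (e ∷ es) = (e ◅ ε) ∷ All.map (e ◅_) (Path-reachable es)

  -- By `E-separates` an `E`-component meets every label at most once, so a simple path in it
  -- projects to a simple path of `T`.
  Unique⇒LabelSimple : ∀ {x ys y} → Path E x ys y → Unique (x ∷ ys) → LabelSimple (x ∷ ys)
  Unique⇒LabelSimple [] u = [] ∷ []
  Unique⇒LabelSimple p@(_ ∷ es) (x≢ ∷ u) =
    All.zipWith (λ (x≢y , s) y≡x → x≢y (E-separates s (sym y≡x))) (x≢ , Path-reachable p)
      ∷ Unique⇒LabelSimple es u

  record Crossing (p q : Fin N) (z z′ : I) : Set where
    field
      {a b}    : I
      before   : Star Up z a
      crossing : Up a b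
      after    : Star Up b z′
      label-a  : label a ≡ p
      label-b  : label b ≡ q

  -- The rest of the `E`-path joins `label x′` to `label y` away from `label x`, and so does the
  -- walk after its last visit to `label x`, starting from the label where it lands. Both are
  -- neighbours of `label x` in one component of its complement, hence equal.
  crossing : ∀ {x x′ ys y z z′} → E x x′ → Path E x′ ys y →
             All (λ w → label w ≢ label x) (x′ ∷ ys) →
             Star Up z z′ → label z ≡ label x → label z′ ≡ label y →
             Crossing (label x) (label x′) z z′
  crossing {x} {x′} e es (x′≢ ∷ ys≢) zs z≡x z′≡y with y≢ ← All-last es x′≢ ys≢
    with lastVisit (label x) zs (λ z′≡x → y≢ (trans (sym z′≡y) z′≡x))
  ... | inj₁ ε = contradiction (trans (sym z′≡y) z≡x) y≢
  ... | inj₁ ((_ , z≢ , _) ◅ _) = contradiction z≡x z≢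
  ... | inj₂ (a , b , before , a≡x , s , after) = record
    { before = before ; crossing = s ; after = Star.map proj₁ after
    ; label-a = a≡x
    ; label-b = acyclic⇒unique-neighbour T acyclic
        (subst (_∼ label b) a≡x (Up-adjacent s)) (E-adjacent e)
        (subst (Star (AvoidingStep T (label x)) (label b)) z′≡y (avoidingWalk _ after) ◅◅
         avoidingPath _ es x′≢ ys≢)
    }

  -- The crossing rises at least as much as the first edge, the walk after it is compared with the
  -- rest of the path, and the walk before it ascends. Only the labels of the ends are matched,
  -- since a crossing reaches the label of the next cube but perhaps not that cube.
  path-steepest : ∀ {x ys y z z′} → Path E x ys y → LabelSimple (x ∷ ys) → Star Up z z′ →
                  label z ≡ label x → label z′ ≡ label y → Rise x y ≤ Rise z z′
  path-steepest {x} {z′ = z′} [] _ zs _ _ =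
    ≤-respˡ-≈ (≈-trans (-‿inverseʳ (height z′)) (≈-sym (-‿inverseʳ (height x))))
              (Rise-monoˡ z′ (ascending zs))
  path-steepest {x} {y ∷ ys} (e ∷ es) (x≢ ∷ simple) zs z≡x z′≡y = ≤-trans
    (≤-respˡ-≈ (Rise-+ _ _ _) (≤-respʳ-≈ (Rise-+ _ _ _) (+-mono-≤
      (E-steepest e C.crossing (sym C.label-a) (sym C.label-b))
      (path-steepest es simple C.after C.label-b z′≡y))))
    (Rise-monoˡ _ (ascending C.before))
    where
    module C = Crossing (crossing e es x≢ zs z≡x z′≡y)

  -- With both ends in common the total rises are equal, so the inequalities of `path-steepest` are
  -- tight: nothing precedes the crossing, and it ends at the height of `x′`. Injectivity of
  -- `height` then identifies the cubes.
  firstStep : ∀ {x y} → Star E x y → x ≢ y → Star Up x y → ∃ λ z → E x z × Up x z × Star Up z y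
  firstStep {x} {y} es x≢y ss with loopErasure _≟ᴵ_ es
  ... | _ , [] , _ = contradiction refl x≢y
  ... | _ , path@(_∷_ {y = x′} e p) , u
    with label≢ ∷ simple ← Unique⇒LabelSimple path u
    with crossing e p label≢ ss refl refl
  ...   | record { b = b ; before = before ; crossing = s ; after = after
                 ; label-a = a≡x ; label-b = b≡x′ } = conclude before s
    where
    x′y≤by : Rise x′ y ≤ Rise b y
    x′y≤by = path-steepest p simple after b≡x′ refl

    conclude : Star Up x _ → Up _ b → ∃ λ z → E x z × Up x z × Star Up z y
    conclude ε s = b , subst (E x) x′≡b e , s , after
      where
      x′≡b : x′ ≡ b
      x′≡b = height-injective (≤-antisym
        (Rise-cancelʳ x (E-steepest e s refl (sym b≡x′))) (Rise-cancelˡ y x′y≤by))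
    -- The crossing would start strictly above `x`, although from there to `y` the walk still rises
    -- at least as much as from `x` to `y`.
    conclude (s₀ ◅ ss₀) _ = contradiction
      (Rise-cancelˡ y (≤-respˡ-≈ (Rise-+ x x′ y) (≤-respʳ-≈ (Rise-+ _ b y)
        (+-mono-≤ (E-steepest e s (sym a≡x) (sym b≡x′)) x′y≤by))))
      (<⇒≱ (<-≤-trans (Up-mono s₀) (ascending ss₀)))

-- Real numbers

additiveGroup : Reals → OrderedGroup
additiveGroup R = record
  { isAbelianGroup     = CommutativeRing.+-isAbelianGroup (Reals.commutativeRing R)
  ; isStrictTotalOrder = Reals.isStrictTotalOrder R
  ; +-monoˡ-<          = Reals.+-monoˡ-< R
  }

module RealProperties (R : Reals) where

  open OrderedGroup (additiveGroup R) public renaming (Carrier to ℝ)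
  open Reals R public using (_*_; 1#; 0<1; inverse; *-positive; commutativeRing; sum)
  open CommutativeRing commutativeRing public
    using (*-cong; *-congˡ; *-congʳ; *-comm; *-assoc; *-identityˡ; *-identityʳ;
           distribˡ; distribʳ; zeroˡ; zeroʳ; ring)
  open RingProperties ring using (-‿distribˡ-*; -‿distribʳ-*)

  *-monoˡ-< : ∀ {x y z} → 0# < z → x < y → x * z < y * z
  *-monoˡ-< {x} {y} {z} 0<z x<y = +-cancelʳ-< (- (x * z)) (<-respˡ-≈ (≈-sym (-‿inverseʳ (x * z)))
    (<-respʳ-≈ (≈-trans (distribʳ z y (- x)) (+-congˡ (≈-sym (-‿distribˡ-* x z))))
      (*-positive (x<y⇒0<y-x x<y) 0<z)))

  *-monoˡ-≤ : ∀ {x y z} → 0# ≤ z → x ≤ y → x * z ≤ y * z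
  *-monoˡ-≤ _ (inj₂ x≈y) = inj₂ (*-congʳ x≈y)
  *-monoˡ-≤ (inj₁ 0<z) (inj₁ x<y) = inj₁ (*-monoˡ-< 0<z x<y)
  *-monoˡ-≤ {x} {y} (inj₂ 0≈z) (inj₁ _) =
    inj₂ (≈-trans (*-congˡ (≈-sym 0≈z)) (≈-trans (zeroʳ x) (≈-trans (≈-sym (zeroʳ y)) (*-congˡ 0≈z))))

  *-monoʳ-≤ : ∀ {x y z} → 0# ≤ z → x ≤ y → z * x ≤ z * y
  *-monoʳ-≤ 0≤z x≤y = ≤-respˡ-≈ (*-comm _ _) (≤-respʳ-≈ (*-comm _ _) (*-monoˡ-≤ 0≤z x≤y))

  square-mono-≤ : ∀ {x y} → 0# ≤ x → x ≤ y → x * x ≤ y * y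
  square-mono-≤ 0≤x x≤y = ≤-trans (*-monoˡ-≤ 0≤x x≤y) (*-monoʳ-≤ (≤-trans 0≤x x≤y) x≤y)

  square-cancel-≤ : ∀ {x y} → 0# ≤ y → x * x ≤ y * y → x ≤ y
  square-cancel-≤ {x} {y} 0≤y xx≤yy with <-≤-connex y x
  ... | inj₂ x≤y = x≤y
  ... | inj₁ y<x = contradiction xx≤yy
    (<⇒≱ (≤-<-trans (*-monoʳ-≤ 0≤y (inj₁ y<x)) (*-monoˡ-< (≤-<-trans 0≤y y<x) y<x)))

  square-neg : ∀ x → (- x) * (- x) ≈ x * x
  square-neg x = ≈-trans (≈-sym (-‿distribˡ-* x (- x)))
    (≈-trans (-‿cong (≈-sym (-‿distribʳ-* x x))) (-‿involutive (x * x)))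

  -0≈0 : - 0# ≈ 0#
  -0≈0 = ≈-trans (≈-sym (+-identityˡ (- 0#))) (-‿inverseʳ 0#)

  square-nonnegative : ∀ x → 0# ≤ x * x
  square-nonnegative x with compare 0# x
  ... | tri< 0<x _ _ = inj₁ (*-positive 0<x 0<x)
  ... | tri≈ _ 0≈x _ = inj₂ (≈-trans (≈-sym (zeroˡ x)) (*-congʳ 0≈x))
  ... | tri> _ _ x<0 = inj₁ (<-respʳ-≈ (square-neg x) (*-positive 0<-x 0<-x))
    where
    0<-x = <-respˡ-≈ -0≈0 (neg-mono-< x<0)

  2# : ℝ
  2# = 1# + 1#

  0<2 : 0# < 2#
  0<2 = <-trans 0<1 (<-respˡ-≈ (+-identityˡ 1#) (+-monoˡ-< 1# 0<1))

  x*2≈x+x : ∀ x → x * 2# ≈ x + x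
  x*2≈x+x x = ≈-trans (distribˡ x 1# 1#) (+-cong (*-identityʳ x) (*-identityʳ x))

  halve : ∀ x → ∃ λ y → y + y ≈ x
  halve x with h , 2h≈1 ← inverse 2# (λ 2≈0 → irrefl (≈-sym 2≈0) 0<2) =
    x * h , ≈-trans (≈-sym (x*2≈x+x (x * h))) (≈-trans (*-assoc x h 2#)
      (≈-trans (*-congˡ (≈-trans (*-comm h 2#) 2h≈1)) (*-identityʳ x)))

  double-cancel-< : ∀ {x y} → x + x < y + y → x < y
  double-cancel-< {x} {y} p with <-≤-connex x y
  ... | inj₁ x<y = x<y
  ... | inj₂ y≤x = contradiction (+-mono-≤ y≤x y≤x) (<⇒≱ p)

  dense : ∀ {x y} → x < y → ∃ λ z → x < z × z < y
  dense {x} {y} x<y with z , z+z≈ ← halve (x + y) =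
    z , double-cancel-< (<-respʳ-≈ (≈-sym z+z≈) (+-monoʳ-< x x<y))
      , double-cancel-< (<-respˡ-≈ (≈-sym z+z≈) (+-monoˡ-< y x<y))

  smallerThanBoth : ∀ {x y} → 0# < x → 0# < y → ∃ λ z → 0# < z × z ≤ x × z ≤ y
  smallerThanBoth {x} {y} 0<x 0<y with ≤-total x y
  ... | inj₁ x≤y = x , 0<x , ≤-refl , x≤y
  ... | inj₂ y≤x = y , 0<y , y≤x , ≤-refl

  smallerThanAll : ∀ {m} (x : Vector ℝ m) → (∀ j → 0# < x j) → ∃ λ z → 0# < z × (∀ j → z ≤ x j)
  smallerThanAll {zero}  x 0<x = 1# , 0<1 , λ ()
  smallerThanAll {suc m} x 0<x with y , 0<y , y≤ ← smallerThanAll (x ∘ suc) (0<x ∘ suc)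
    with z , 0<z , z≤x , z≤y ← smallerThanBoth (0<x zero) 0<y =
    z , 0<z , λ { zero → z≤x ; (suc j) → ≤-trans z≤y (y≤ j) }

  Outside : ℝ → ℝ → ℝ → Set
  Outside l u x = x < l ⊎ u < x

  -- Each listed value is removed by cutting the current interval at an inner point and keeping the
  -- side that does not contain it.
  avoid : ∀ xs {l u} → l < u → ∃₂ λ l′ u′ → l ≤ l′ × l′ < u′ × u′ ≤ u × All (Outside l′ u′) xs
  avoid [] l<u = _ , _ , ≤-refl , l<u , ≤-refl , []
  avoid (x ∷ xs) l<u with l₁ , u₁ , l≤l₁ , l₁<u₁ , u₁≤u , out ← avoid xs l<u
    with m , l₁<m , m<u₁ ← dense l₁<u₁ with <-≤-connex x m
  ... | inj₁ x<m = m , u₁ , ≤-trans l≤l₁ (inj₁ l₁<m) , m<u₁ , u₁≤u ,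
    inj₁ x<m ∷ All.map (Sum.map₁ (λ y<l₁ → <-trans y<l₁ l₁<m)) out
  -- Here `x` may equal `m`, so the right end moves to a smaller `k` to leave `x` strictly outside.
  ... | inj₂ m≤x with k , l₁<k , k<m ← dense l₁<m =
    l₁ , k , l≤l₁ , l₁<k , ≤-trans (inj₁ (<-trans k<m m<u₁)) u₁≤u ,
    inj₂ (<-≤-trans k<m m≤x) ∷ All.map (Sum.map₂ (<-trans (<-trans k<m m<u₁))) out

  generic : ∀ xs {l u} → l < u → ∃₂ λ q r → 0# < r × l ≤ q × q ≤ u × All (Outside (q - r) (q + r)) xs
  generic xs l<u with l′ , u′ , l≤l′ , l′<u′ , u′≤u , out ← avoid xs l<u
    with q , l′<q , q<u′ ← dense l′<u′
    with r , 0<r , r≤q-l′ , r≤u′-q ← smallerThanBoth (x<y⇒0<y-x l′<q) (x<y⇒0<y-x q<u′) =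
    q , r , 0<r , ≤-trans l≤l′ (inj₁ l′<q) , ≤-trans (inj₁ q<u′) u′≤u ,
    All.map (Sum.map (λ x<l′ → <-≤-trans x<l′ l′≤) (≤-<-trans ≤u′)) out
    where
    l′≤ : l′ ≤ q - r
    l′≤ = +-cancelʳ-≤ r (≤-respʳ-≈ (≈-sym (x-y+y≈x q r)) (≤-respˡ-≈ (+-comm r l′)
      (≤-respʳ-≈ (x-y+y≈x q l′) (+-monoˡ-≤ l′ r≤q-l′))))
    ≤u′ : q + r ≤ u′
    ≤u′ = ≤-respˡ-≈ (+-comm r q) (≤-respʳ-≈ (x-y+y≈x u′ q) (+-monoˡ-≤ q r≤u′-q))

  Outside-shrink : ∀ {q r r′ x} → r′ ≤ r → Outside (q - r) (q + r) x → Outside (q - r′) (q + r′) x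
  Outside-shrink {q} {r} {r′} r′≤r = Sum.map
    (λ x<q-r → <-≤-trans x<q-r (≤-resp r′≤r))
    (≤-<-trans (+-monoʳ-≤ q r′≤r))
    where
    ≤-resp : r′ ≤ r → q - r ≤ q - r′
    ≤-resp (inj₁ r′<r) = inj₁ (+-monoʳ-< q (neg-mono-< r′<r))
    ≤-resp (inj₂ r′≈r) = inj₂ (+-congˡ (-‿cong (≈-sym r′≈r)))

  -- Each coordinate has its own window; the least of their radii serves them all, as a channel has
  -- a single radius.
  genericPoint : ∀ {m} (xs : Fin m → List ℝ) (c : Vector ℝ m) {δ} → 0# < δ →
    ∃₂ λ q r → 0# < r × (∀ j → c j ≤ q j × q j ≤ c j + δ × All (Outside (q j - r) (q j + r)) (xs j))
  genericPoint xs c {δ} 0<δ = proj₁ ∘ window , r , 0<r , λ j →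
    let _ , _ , _ , c≤q , q≤c+δ , out = window j in c≤q , q≤c+δ , All.map (Outside-shrink (r≤ j)) out
    where
    window = λ j → generic (xs j) (<-respˡ-≈ (+-identityʳ (c j)) (+-monoʳ-< (c j) 0<δ))
    minimal = smallerThanAll (proj₁ ∘ proj₂ ∘ window) (λ j → proj₁ (proj₂ (proj₂ (window j))))
    r = proj₁ minimal
    0<r = proj₁ (proj₂ minimal)
    r≤ = proj₂ (proj₂ minimal)

  sum-cong : ∀ {m} {t s : Vector ℝ m} → (∀ j → t j ≈ s j) → sum t ≈ sum s
  sum-cong {zero}  t≈s = ≈-refl
  sum-cong {suc m} t≈s = +-cong (t≈s zero) (sum-cong (t≈s ∘ suc))

  sum-nonnegative : ∀ {m} (t : Vector ℝ m) → (∀ j → 0# ≤ t j) → 0# ≤ sum t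
  sum-nonnegative {zero}  t 0≤t = ≤-refl
  sum-nonnegative {suc m} t 0≤t = ≤-respˡ-≈ (+-identityˡ 0#)
    (+-mono-≤ (0≤t zero) (sum-nonnegative (t ∘ suc) (0≤t ∘ suc)))

  term≤sum : ∀ {m} (t : Vector ℝ m) → (∀ j → 0# ≤ t j) → ∀ j → t j ≤ sum t
  term≤sum t 0≤t zero    = ≤-respˡ-≈ (+-identityʳ _) (+-monoʳ-≤ (t zero) (sum-nonnegative _ (0≤t ∘ suc)))
  term≤sum t 0≤t (suc j) = ≤-trans (term≤sum (t ∘ suc) (0≤t ∘ suc) j)
    (≤-respˡ-≈ (+-identityˡ _) (+-monoˡ-≤ _ (0≤t zero)))

  smallSum : ∀ m {b} → 0# < b → ∃ λ δ → 0# < δ × (∀ (t : Vector ℝ m) → (∀ j → t j ≤ δ) → sum t ≤ b)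
  smallSum zero    0<b = 1# , 0<1 , λ _ _ → inj₁ 0<b
  smallSum (suc m) {b} 0<b with h , h+h≈b ← halve b
    with 0<h ← double-cancel-< (<-respˡ-≈ (≈-sym (+-identityˡ 0#)) (<-respʳ-≈ (≈-sym h+h≈b) 0<b))
    with δ , 0<δ , small ← smallSum m 0<h
    with η , 0<η , η≤h , η≤δ ← smallerThanBoth 0<h 0<δ =
    η , 0<η , λ t t≤η → ≤-respʳ-≈ h+h≈b
      (+-mono-≤ (≤-trans (t≤η zero) η≤h) (small (t ∘ suc) (λ j → ≤-trans (t≤η (suc j)) η≤δ)))

  module _ {m : ℕ} (axis : Fin m) where

    private
      term : Vector ℝ m → Vector ℝ m → Vector ℝ m
      term p q j = if does (j ≟ axis) then 0# else (p j - q j) * (p j - q j)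

    dist²-cong : ∀ {p q p′ q′} → (∀ j → j ≢ axis → p j - q j ≈ p′ j - q′ j) →
                 dist² R axis p q ≈ dist² R axis p′ q′
    dist²-cong {p} {q} {p′} {q′} eq = sum-cong term-cong
      where
      term-cong : ∀ j → term p q j ≈ term p′ q′ j
      term-cong j with j ≟ axis
      ... | yes _      = ≈-refl
      ... | no  j≢axis = *-cong (eq j j≢axis) (eq j j≢axis)

    ball⊆box : ∀ {p c r} → 0# ≤ r → dist² R axis p c ≤ r * r →
               ∀ j → j ≢ axis → c j - r ≤ p j × p j ≤ c j + r
    ball⊆box {p} {c} {r} 0≤r d≤ j j≢axis =
      ≤-respʳ-≈ (back (p j) (c j))
        (+-monoʳ-≤ (c j) (-≤ (square-cancel-≤ 0≤r (≤-respˡ-≈ (≈-sym (square-neg _)) square≤)))) ,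
      ≤-respˡ-≈ (≈-trans (+-comm _ _) (x-y+y≈x (p j) (c j))) (+-monoʳ-≤ (c j) (square-cancel-≤ 0≤r square≤))
      where
      term≥0 : ∀ j → 0# ≤ term p c j
      term≥0 j with j ≟ axis
      ... | yes _ = ≤-refl
      ... | no  _ = square-nonnegative _
      term≡ : term p c j ≡ (p j - c j) * (p j - c j)
      term≡ with j ≟ axis
      ... | yes j≡axis = contradiction j≡axis j≢axis
      ... | no  _      = refl
      square≤ : (p j - c j) * (p j - c j) ≤ r * r
      square≤ = ≤-trans (subst (_≤ sum (term p c)) term≡ (term≤sum _ term≥0 j)) d≤
      -≤ : ∀ {x y} → - x ≤ y → - y ≤ x
      -≤ (inj₁ lt) = inj₁ (<-respʳ-≈ (-‿involutive _) (neg-mono-< lt))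
      -≤ (inj₂ eq) = inj₂ (≈-trans (-‿cong (≈-sym eq)) (-‿involutive _))
      back : ∀ x y → y + (x - y) ≈ x
      back x y = ≈-trans (+-comm _ _) (x-y+y≈x x y)

    -- With `η` at most 1 its square is at most `η`, hence at most the share that `smallSum` allots
    -- to each coordinate, and no square root is taken. The box is one-sided because generic points
    -- are sought upwards from the centre.
    box⊆ball : ∀ {r} → 0# < r → ∃ λ η → 0# < η ×
               (∀ {p c} → (∀ j → j ≢ axis → c j ≤ p j × p j ≤ c j + η) → dist² R axis p c ≤ r * r)
    box⊆ball {r} 0<r with δ , 0<δ , small ← smallSum m (*-positive 0<r 0<r)
      with η , 0<η , η≤1 , η≤δ ← smallerThanBoth 0<1 0<δ = η , 0<η , λ {p} {c} box → small _ (term≤δ p c box)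
      where
      η²≤δ : η * η ≤ δ
      η²≤δ = ≤-trans (*-monoˡ-≤ (inj₁ 0<η) η≤1) (≤-respˡ-≈ (≈-sym (*-identityˡ η)) η≤δ)
      term≤δ : ∀ p c → (∀ j → j ≢ axis → c j ≤ p j × p j ≤ c j + η) → ∀ j → term p c j ≤ δ
      term≤δ p c box j with j ≟ axis
      ... | yes _      = inj₁ 0<δ
      ... | no  j≢axis with c≤p , p≤c+η ← box j j≢axis = ≤-trans (square-mono-≤
        (≤-respˡ-≈ (-‿inverseʳ (c j)) (+-monoˡ-≤ (- c j) c≤p)) (x≤y+z⇒x-y≤z p≤c+η)) η²≤δ

-- Boxes and channels

-- The common ground of the two models: regions are products of intervals, and along an axis of
-- sight all of them have the same length `width`. `anAxis` records that the dimension is positive.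
record BoxModel {R : Reals} (M : Model R) : Set where
  open Model M
  open RealProperties R
  field
    lo hi       : Cube → Vector ℝ dim
    region⇒box  : ∀ {A p} → region A p → ∀ j → lo A j ≤ p j × p j ≤ hi A j
    box⇒region  : ∀ {A p} → (∀ j → lo A j ≤ p j × p j ≤ hi A j) → region A p
    width       : ℝ
    0≤width     : 0# ≤ width
    hi≈lo+width : ∀ A {i} → Sightway i → hi A i ≈ lo A i + width
    shift       : ℝ → Cube → Cube
    lo-shift    : ∀ s A j → lo (shift s A) j ≈ lo A j + s
    hi-shift    : ∀ s A j → hi (shift s A) j ≈ hi A j + s
    anAxis      : Fin dim

module _ {A : Set} {m : ℕ} where

  _[_]≔_ : Vector A m → Fin m → A → Vector A m
  (q [ i ]≔ t) j = if does (j ≟ i) then t else q j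

  []≔-at : ∀ q i t → (q [ i ]≔ t) i ≡ t
  []≔-at q i t with i ≟ i
  ... | yes _   = refl
  ... | no  i≢i = contradiction refl i≢i

  []≔-off : ∀ q {i} t {j} → j ≢ i → (q [ i ]≔ t) j ≡ q j
  []≔-off q {i} t {j} j≢i with j ≟ i
  ... | yes j≡i = contradiction j≡i j≢i
  ... | no  _   = refl

module ChannelProperties {R : Reals} {m : ℕ} {axis : Fin m} (K : Channel R axis) where

  open RealProperties R
  open Channel K

  CrossSection-off : ∀ {p q} → (∀ j → j ≢ axis → p j ≈ q j) → CrossSection p → CrossSection q
  CrossSection-off p≈q = ≤-respˡ-≈ (dist²-cong axis λ j j≢axis → +-congʳ (p≈q j j≢axis))

  CrossSection-[]≔ : ∀ {q} t → CrossSection q → CrossSection (q [ axis ]≔ t)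
  CrossSection-[]≔ {q} t = CrossSection-off λ j j≢axis → ≈-reflexive (sym ([]≔-off q t j≢axis))

  -- With radius zero, `ball⊆box` would pin every coordinate off the axis to that of the centre,
  -- against the two distinct points of the cross-section.
  0<radius : 0# < radius
  0<radius with 0≤radius
  ... | inj₁ 0<r = 0<r
  ... | inj₂ 0≈r with p , q , p∈ , q∈ , j , j≢axis , p≉q ← positiveDiameter =
    contradiction (≈-trans (central p∈) (≈-sym (central q∈))) p≉q
    where
    central : ∀ {x} → CrossSection x → x j ≈ centre j
    central x∈ with c-r≤x , x≤c+r ← ball⊆box axis 0≤radius x∈ j j≢axis = ≤-antisym
      (≤-respʳ-≈ (≈-trans (+-congˡ (≈-sym 0≈r)) (+-identityʳ _)) x≤c+r)
      (≤-respˡ-≈ (≈-trans (+-congˡ (≈-trans (-‿cong (≈-sym 0≈r)) -0≈0)) (+-identityʳ _)) c-r≤x)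

  centre-CrossSection : CrossSection centre
  centre-CrossSection with η , 0<η , box ← box⊆ball axis 0<radius =
    box λ j _ → ≤-refl , inj₁ (<-respˡ-≈ (+-identityʳ _) (+-monoʳ-< _ 0<η))

  -- Cubes joined by a channel overlap in this coordinate, so translated pieces are later told apart
  -- by it.
  transverse : ∃ λ j → j ≢ axis
  transverse with _ , _ , _ , _ , j , j≢axis , _ ← positiveDiameter = j , j≢axis

  inCylinder : ∀ {q t} → CrossSection q → start ≤ t → t ≤ finish → Cylinder (q [ axis ]≔ t)
  inCylinder {q} {t} q∈ start≤t t≤finish = CrossSection-[]≔ t q∈ ,
    ≤-respʳ-≈ (≈-reflexive (sym ([]≔-at q axis t))) start≤t ,
    ≤-respˡ-≈ (≈-reflexive (sym ([]≔-at q axis t))) t≤finish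

module Beams {R : Reals} {M : Model R} (B : BoxModel M) where

  open Model M
  open BoxModel B
  open RealProperties R

  Shades : Fin dim → Vector ℝ dim → Cube → Set
  Shades i q A = ∀ j → j ≢ i → lo A j ≤ q j × q j ≤ hi A j

  pierce : ∀ {i q t A} → Shades i q A → lo A i ≤ t → t ≤ hi A i → region A (q [ i ]≔ t)
  pierce {i} {q} {t} {A} shades lo≤t t≤hi = box⇒region λ j → inside j (j ≟ i)
    where
    inside : ∀ j → Dec (j ≡ i) → lo A j ≤ (q [ i ]≔ t) j × (q [ i ]≔ t) j ≤ hi A j
    inside j (yes refl) rewrite []≔-at q j t = lo≤t , t≤hi
    inside j (no  j≢i)    rewrite []≔-off q t j≢i = shades j j≢i

  lo≤lo+width : ∀ A i → lo A i ≤ lo A i + width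
  lo≤lo+width A i = ≤-respˡ-≈ (+-identityʳ _) (+-monoʳ-≤ _ 0≤width)

  lo≤hi : ∀ A {i} → Sightway i → lo A i ≤ hi A i
  lo≤hi A sight = ≤-respʳ-≈ (≈-sym (hi≈lo+width A sight)) (lo≤lo+width A _)

  -- If neither cube lies strictly beyond the other, the lower face of the one that starts later is
  -- within the range of the other, and the line through `q` meets both at that height.
  separated : ∀ {i q A C} → Sightway i → Shades i q A → Shades i q C → Disjoint R (region A) (region C) →
              lo A i + width < lo C i ⊎ lo C i + width < lo A i
  separated {i} {q} {A} {C} sight shA shC disjoint
    with <-≤-connex (lo A i + width) (lo C i) | <-≤-connex (lo C i + width) (lo A i)
  ... | inj₁ A<C | _        = inj₁ A<C
  ... | _        | inj₁ C<A = inj₂ C<A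
  ... | inj₂ C≤A | inj₂ A≤C with ≤-total (lo A i) (lo C i)
  ...   | inj₁ A≤C′ = contradiction
    (pierce shA A≤C′ (≤-respʳ-≈ (≈-sym (hi≈lo+width A sight)) C≤A) ,
     pierce shC ≤-refl (lo≤hi C sight)) (disjoint _)
  ...   | inj₂ C≤A′ = contradiction
    (pierce shA ≤-refl (lo≤hi A sight) ,
     pierce shC C≤A′ (≤-respʳ-≈ (≈-sym (hi≈lo+width C sight)) A≤C)) (disjoint _)

  record Beam (i : Fin dim) (A C : Cube) : Set where
    field
      channel : Channel R i
    open Channel channel public
    open ChannelProperties channel public
    field
      start⊆  : _⊆ᴿ_ R StartFace (region A)
      finish⊆ : _⊆ᴿ_ R FinishFace (region C)

    startPoint : ∀ {q} → CrossSection q → region A (q [ i ]≔ start)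
    startPoint {q} q∈ = start⊆ _ (CrossSection-[]≔ start q∈ , ≈-reflexive ([]≔-at q i start))

    finishPoint : ∀ {q} → CrossSection q → region C (q [ i ]≔ finish)
    finishPoint {q} q∈ = finish⊆ _ (CrossSection-[]≔ finish q∈ , ≈-reflexive ([]≔-at q i finish))

    shadesˢ : ∀ {q} → CrossSection q → Shades i q A
    shadesˢ {q} q∈ j j≢i = subst (λ x → lo A j ≤ x × x ≤ hi A j) ([]≔-off q start j≢i)
      (region⇒box (startPoint q∈) j)

    shadesᶠ : ∀ {q} → CrossSection q → Shades i q C
    shadesᶠ {q} q∈ j j≢i = subst (λ x → lo C j ≤ x × x ≤ hi C j) ([]≔-off q finish j≢i)
      (region⇒box (finishPoint q∈) j)

    startRange : lo A i ≤ start × start ≤ hi A i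
    startRange = subst (λ x → lo A i ≤ x × x ≤ hi A i) ([]≔-at centre i start)
      (region⇒box (startPoint centre-CrossSection) i)

    finishRange : lo C i ≤ finish × finish ≤ hi C i
    finishRange = subst (λ x → lo C i ≤ x × x ≤ hi C i) ([]≔-at centre i finish)
      (region⇒box (finishPoint centre-CrossSection) i)

    lo-gap : Sightway i → Disjoint R (region A) (region C) → lo A i + width < lo C i
    lo-gap sight disjoint
      with separated sight (shadesˢ centre-CrossSection) (shadesᶠ centre-CrossSection) disjoint
    ... | inj₁ A<C = A<C
    ... | inj₂ C<A = contradiction start<finish
      (λ s<f → <⇒≱ s<f (≤-trans (proj₂ finishRange)
        (≤-trans (≤-respˡ-≈ (≈-sym (hi≈lo+width C sight)) (inj₁ C<A)) (proj₁ startRange))))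

    -- Both intervals in coordinate `j` contain that coordinate of the centre, so they overlap.
    -- Together with `lo-gap` this bounds the displacement along any other axis of sight by the
    -- length of the sighting.
    lo-near : ∀ {j} → Sightway j → j ≢ i → lo C j ≤ lo A j + width × lo A j ≤ lo C j + width
    lo-near {j} sight j≢i with A≤ , ≤A ← shadesˢ centre-CrossSection j j≢i
      | C≤ , ≤C ← shadesᶠ centre-CrossSection j j≢i =
      ≤-respʳ-≈ (hi≈lo+width A sight) (≤-trans C≤ ≤A) , ≤-respʳ-≈ (hi≈lo+width C sight) (≤-trans A≤ ≤C)

-- Visibility along generic lines

module Sight {R : Reals} {M : Model R} (B : BoxModel M) (N : ℕ) {I : Set} (cube : I → Model.Cube M) where

  open Model M
  open BoxModel B
  open RealProperties R
  open Beams B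

  record Up (i : Fin dim) (x y : I) : Set where
    field
      distinct : x ≢ y
      sightway : Sightway i
      beam     : Beam i (cube x) (cube y)
    open Beam beam public
    field
      clear : ∀ z → z ≢ x → z ≢ y → Disjoint R Cylinder (region (cube z))

  Up⇒Sees : ∀ {i x y} → Up i x y → Sees M {N} cube x y
  Up⇒Sees {i = i} u = i , Up.sightway u , Up.channel u , inj₁ (Up.start⊆ u , Up.finish⊆ u) , Up.clear u

  Sees⇒Up : ∀ {x y} → x ≢ y → Sees M {N} cube x y → ∃ λ i → Up i x y ⊎ Up i y x
  Sees⇒Up x≢y (i , sight , K , inj₁ (s , f) , clear) = i , inj₁ record
    { distinct = x≢y ; sightway = sight
    ; beam = record { channel = K ; start⊆ = s ; finish⊆ = f } ; clear = clear }
  Sees⇒Up x≢y (i , sight , K , inj₂ (s , f) , clear) = i , inj₂ record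
    { distinct = x≢y ∘ sym ; sightway = sight
    ; beam = record { channel = K ; start⊆ = s ; finish⊆ = f } ; clear = λ z z≢y z≢x → clear z z≢x z≢y }

  Sees-sym : ∀ {x y} → Sees M {N} cube x y → Sees M {N} cube y x
  Sees-sym (i , sight , K , joins , clear) =
    i , sight , K , Sum.swap joins , λ z z≢y z≢x → clear z z≢x z≢y

  module _ (em : ExcludedMiddle 0ℓ) (elements : List I) (complete : ∀ x → x ∈ elements)
    (disjoint : ∀ x y → x ≢ y → Disjoint R (region (cube x)) (region (cube y))) where

    module Line {i : Fin dim} (sight : Sightway i) (transverse : ∃ λ j → j ≢ i)
      (q : Vector ℝ dim) {r : ℝ} (0<r : 0# < r)
      (lo-outside : ∀ x j → Outside (q j - r) (q j + r) (lo (cube x) j))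
      (hi-outside : ∀ x j → Outside (q j - r) (q j + r) (hi (cube x) j)) where

      On : I → Set
      On x = Shades i q (cube x)

      Between : I → I → I → Set
      Between x y z = On z × lo (cube x) i < lo (cube z) i × lo (cube z) i < lo (cube y) i

      q≤q+r : ∀ j → q j ≤ q j + r
      q≤q+r j = ≤-respˡ-≈ (+-identityʳ (q j)) (+-monoʳ-≤ (q j) (inj₁ 0<r))

      q-r≤q : ∀ j → q j - r ≤ q j
      q-r≤q j = ≤-respʳ-≈ (x-y+y≈x (q j) r) (≤-respˡ-≈ (+-identityʳ _) (+-monoʳ-≤ _ (inj₁ 0<r)))

      -- No face of a cube meets the window around q, so a cube whose shadow
      -- meets the window covers it.
      cover : ∀ x j {t} → lo (cube x) j ≤ q j × q j ≤ hi (cube x) j →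
              q j - r ≤ t × t ≤ q j + r → lo (cube x) j ≤ t × t ≤ hi (cube x) j
      cover x j (lo≤q , q≤hi) (q-r≤t , t≤q+r) = lower (lo-outside x j) , upper (hi-outside x j)
        where
        lower : Outside (q j - r) (q j + r) (lo (cube x) j) → _
        lower (inj₁ lo<) = inj₁ (<-≤-trans lo< q-r≤t)
        lower (inj₂ <lo) = contradiction (≤-trans lo≤q (q≤q+r j)) (<⇒≱ <lo)
        upper : Outside (q j - r) (q j + r) (hi (cube x) j) → _
        upper (inj₁ hi<) = contradiction (≤-trans (q-r≤q j) q≤hi) (<⇒≱ hi<)
        upper (inj₂ <hi) = inj₁ (≤-<-trans t≤q+r <hi)

      hit : ∀ x j {t} → lo (cube x) j ≤ t × t ≤ hi (cube x) j →
            q j - r ≤ t × t ≤ q j + r → lo (cube x) j ≤ q j × q j ≤ hi (cube x) j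
      hit x j (lo≤t , t≤hi) (q-r≤t , t≤q+r) = lower (lo-outside x j) , upper (hi-outside x j)
        where
        lower : Outside (q j - r) (q j + r) (lo (cube x) j) → _
        lower (inj₁ lo<) = ≤-trans (inj₁ lo<) (q-r≤q j)
        lower (inj₂ <lo) = contradiction (≤-trans lo≤t t≤q+r) (<⇒≱ <lo)
        upper : Outside (q j - r) (q j + r) (hi (cube x) j) → _
        upper (inj₁ hi<) = contradiction (≤-trans q-r≤t t≤hi) (<⇒≱ hi<)
        upper (inj₂ <hi) = ≤-trans (q≤q+r j) (inj₁ <hi)

      On-separated : ∀ {x y} → On x → On y → x ≢ y →
        lo (cube x) i + width < lo (cube y) i ⊎ lo (cube y) i + width < lo (cube x) i
      On-separated onx ony x≢y = separated sight onx ony (disjoint _ _ x≢y)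

      On-gap : ∀ {x y} → On x → On y → lo (cube x) i < lo (cube y) i →
               lo (cube x) i + width < lo (cube y) i
      On-gap {x} {y} onx ony x<y with On-separated onx ony (λ { refl → irrefl ≈-refl x<y })
      ... | inj₁ gap = gap
      ... | inj₂ gap = contradiction (≤-trans (lo≤lo+width _ i) (inj₁ gap)) (<⇒≱ x<y)

      -- The channel is the tube of radius `r` about the line, between the facing sides of the two
      -- cubes; `cover` puts its end faces inside them. By `hit` a third cube meeting the tube meets
      -- the line too, so by `On-separated` it would lie between the two or out of reach of the
      -- tube.
      direct : ∀ {x y} → On x → On y → lo (cube x) i < lo (cube y) i → (∀ z → ¬ Between x y z) → Up i x y
      direct {x} {y} onx ony x<y none = record
        { distinct = λ { refl → irrefl ≈-refl x<y }
        ; sightway = sight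
        ; beam     = record
          { channel = channel
          ; start⊆  = λ p (p∈ , p≈) → inside x onx p∈
              (≤-respʳ-≈ (≈-sym p≈) (lo≤lo+width _ i) , inj₂ (≈-trans p≈ (≈-sym (hi≈lo+width _ sight))))
          ; finish⊆ = λ p (p∈ , p≈) → inside y ony p∈
              (inj₂ (≈-sym p≈) , ≤-respˡ-≈ (≈-sym p≈) (lo≤hi _ sight))
          }
        ; clear    = clear
        }
        where
        ball : ∃ λ η → 0# < η ×
          (∀ {p c} → (∀ j → j ≢ i → c j ≤ p j × p j ≤ c j + η) → dist² R i p c ≤ r * r)
        ball = box⊆ball i 0<r
        η = proj₁ ball

        q<q+η : ∀ j → q j < q j + η
        q<q+η j = <-respˡ-≈ (+-identityʳ (q j)) (+-monoʳ-< (q j) (proj₁ (proj₂ ball)))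

        channel : Channel R i
        channel = record
          { centre = q ; radius = r
          ; start  = lo (cube x) i + width
          ; finish = lo (cube y) i
          ; 0≤radius = inj₁ 0<r
          ; start<finish = On-gap onx ony x<y
          -- The shift of `q` by `η` in all coordinates stays in the box provided by `box⊆ball`.
          ; positiveDiameter = q , (λ j → q j + η) ,
              proj₂ (proj₂ ball) (λ j _ → ≤-refl , inj₁ (q<q+η j)) ,
              proj₂ (proj₂ ball) (λ j _ → inj₁ (q<q+η j) , ≤-refl) ,
              proj₁ transverse , proj₂ transverse , λ eq → irrefl eq (q<q+η _)
          }
        open Channel channel using (CrossSection; Cylinder)

        inside : ∀ z → On z → ∀ {p} → CrossSection p →
                 lo (cube z) i ≤ p i × p i ≤ hi (cube z) i → region (cube z) p
        inside z on {p} p∈ range = box⇒region λ j → bounds j (j ≟ i)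
          where
          bounds : ∀ j → Dec (j ≡ i) → lo (cube z) j ≤ p j × p j ≤ hi (cube z) j
          bounds j (yes refl) = range
          bounds j (no  j≢i)    = cover z j (on j j≢i) (ball⊆box i (inj₁ 0<r) p∈ j j≢i)

        clear : ∀ z → z ≢ x → z ≢ y → Disjoint R Cylinder (region (cube z))
        clear z z≢x z≢y p ((p∈ , start≤p , p≤finish) , p∈z)
          with On-separated onx onz (z≢x ∘ sym) | On-separated onz ony z≢y
          where
          onz : On z
          onz j j≢i = hit z j (region⇒box p∈z j) (ball⊆box i (inj₁ 0<r) p∈ j j≢i)
        ... | inj₁ x<z | inj₁ z<y = none z
          ( (λ j j≢i → hit z j (region⇒box p∈z j) (ball⊆box i (inj₁ 0<r) p∈ j j≢i))
          , ≤-<-trans (lo≤lo+width _ i) x<z , ≤-<-trans (lo≤lo+width _ i) z<y)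
        ... | inj₂ z<x | _ = <⇒≱ z<x (≤-trans (lo≤lo+width _ i)
          (≤-trans start≤p (≤-respʳ-≈ (hi≈lo+width _ sight) (proj₂ (region⇒box p∈z i)))))
        ... | _ | inj₂ y<z = <⇒≱ y<z (≤-trans (proj₁ (region⇒box p∈z i)) (≤-trans p≤finish (lo≤lo+width _ i)))

      UpOn : I → I → Set
      UpOn x y = Up i x y × On y

      chain : ∀ (L : List I) {x y} → On x → On y → lo (cube x) i < lo (cube y) i →
              (∀ z → Between x y z → z ∈ L) → Star UpOn x y
      chain [] onx ony x<y covers = (direct onx ony x<y (λ z b → contradiction (covers z b) λ ()) , ony) ◅ ε
      chain (z ∷ L) {x} {y} onx ony x<y covers with em {Between x y z}
      ... | yes (onz , x<z , z<y) =
        chain L onx onz x<z (λ w (onw , x<w , w<z) → drop w<z (covers w (onw , x<w , <-trans w<z z<y))) ◅◅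
        chain L onz ony z<y (λ w (onw , z<w , w<y) → drop′ z<w (covers w (onw , <-trans x<z z<w , w<y)))
        where
        drop : ∀ {w} → lo (cube w) i < lo (cube z) i → w ∈ z ∷ L → w ∈ L
        drop w<w (here refl) = contradiction w<w (irrefl ≈-refl)
        drop _   (there w∈L)   = w∈L
        drop′ : ∀ {w} → lo (cube z) i < lo (cube w) i → w ∈ z ∷ L → w ∈ L
        drop′ w<w (here refl) = contradiction w<w (irrefl ≈-refl)
        drop′ _   (there w∈L)   = w∈L
      ... | no ¬between = chain L onx ony x<y λ w b → drop b (covers w b)
        where
        drop : ∀ {w} → Between x y w → w ∈ z ∷ L → w ∈ L
        drop b (here refl) = contradiction b ¬between
        drop _ (there w∈L)   = w∈L

    lo-ascending : ∀ {i x y} → Star (Up i) x y → lo (cube x) i ≤ lo (cube y) i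
    lo-ascending ε = ≤-refl
    lo-ascending (u ◅ us) = ≤-trans (inj₁ (≤-<-trans (lo≤lo+width _ _)
      (Up.lo-gap u (Up.sightway u) (disjoint _ _ (Up.distinct u))))) (lo-ascending us)

    Hits : ∀ {i x y} → Beam i (cube x) (cube y) → I → Set
    Hits β z = ∃ λ p → Beam.Cylinder β p × region (cube z) p

    -- Along a generic line of a beam, consecutive cubes see each other.
    beamChain : ∀ {i x y} → x ≢ y → Sightway i → (β : Beam i (cube x) (cube y)) →
                Star (λ w z → Up i w z × (z ≢ y → Hits β z)) x y
    beamChain {i} {x} {y} x≢y sight β = mark ≤-refl (L.chain elements onx ony x<y (λ z _ → complete z))
      where
      module β = Beam β
      gap : lo (cube x) i + width < lo (cube y) i
      gap = β.lo-gap sight (disjoint x y x≢y)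
      x<y : lo (cube x) i < lo (cube y) i
      x<y = ≤-<-trans (lo≤lo+width _ i) gap
      ball = box⊆ball i β.0<radius
      -- The values that the line has to avoid; `ball` tells how far it may move from the centre
      -- without leaving the cross-section.
      faces = λ j → map (λ z → lo (cube z) j) elements ++ map (λ z → hi (cube z) j) elements
      point = genericPoint faces β.centre (proj₁ (proj₂ ball))
      q = proj₁ point
      0<r = proj₁ (proj₂ (proj₂ point))
      near = proj₂ (proj₂ (proj₂ point))
      q∈ : β.CrossSection q
      q∈ = proj₂ (proj₂ ball) λ j _ → proj₁ (near j) , proj₁ (proj₂ (near j))
      module L = Line sight β.transverse q 0<r
        (λ z j → All.lookup (proj₂ (proj₂ (near j))) (∈-++⁺ˡ (∈-map⁺ _ (complete z))))
        (λ z j → All.lookup (proj₂ (proj₂ (near j))) (∈-++⁺ʳ _ (∈-map⁺ _ (complete z))))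
      onx : L.On x
      onx = β.shadesˢ q∈
      ony : L.On y
      ony = β.shadesᶠ q∈
      hits : ∀ {w z} → lo (cube x) i ≤ lo (cube w) i → L.UpOn w z → Star (Up i) z y → z ≢ y → Hits β z
      -- The witness is the point where the line enters `z`; it lies beyond `x` and not beyond the
      -- lower face of `y`, hence within the beam.
      hits {w} {z} x≤w (u , onz) zy _ = q [ i ]≔ lo (cube z) i ,
        β.inCylinder q∈ start≤z z≤finish , pierce onz ≤-refl (lo≤hi _ sight)
        where
        x<z : lo (cube x) i < lo (cube z) i
        x<z = ≤-<-trans x≤w (≤-<-trans (lo≤lo+width _ i)
          (Up.lo-gap u (Up.sightway u) (disjoint _ _ (Up.distinct u))))
        start≤z : β.start ≤ lo (cube z) i
        start≤z = ≤-trans (proj₂ β.startRange)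
          (≤-respˡ-≈ (≈-sym (hi≈lo+width _ sight)) (inj₁ (L.On-gap onx onz x<z)))
        z≤finish : lo (cube z) i ≤ β.finish
        z≤finish = ≤-trans (lo-ascending zy) (proj₁ β.finishRange)
      mark : ∀ {w} → lo (cube x) i ≤ lo (cube w) i → Star L.UpOn w y →
             Star (λ w z → Up i w z × (z ≢ y → Hits β z)) w y
      mark x≤w ε        = ε
      mark x≤w (s ◅ ss) = (proj₁ s , hits x≤w s (Star.map proj₁ ss)) ◅
        mark (≤-trans x≤w (lo-ascending (proj₁ s ◅ ε))) ss

-- Finite enumeration

total : ∀ {k} → (Fin k → ℕ) → ℕ
total {zero}  s = 0
total {suc k} s = s zero ℕ.+ total (s ∘ suc)

Σ-suc : ∀ {k} {P : Fin (suc k) → Set} → Σ (Fin (suc k)) P ↔ (P zero ⊎ Σ (Fin k) (P ∘ suc))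
Σ-suc = mk↔ₛ′
  (λ { (zero , p) → inj₁ p ; (suc i , p) → inj₂ (i , p) })
  (λ { (inj₁ p) → zero , p ; (inj₂ (i , p)) → suc i , p })
  (λ { (inj₁ _) → refl ; (inj₂ _) → refl })
  (λ { (zero , _) → refl ; (suc _ , _) → refl })

flatten : ∀ {k} (s : Fin k → ℕ) → Σ (Fin k) (Fin ∘ s) ↔ Fin (total s)
flatten {zero}  s = mk↔ₛ′ (λ ()) (λ ()) (λ ()) (λ ())
flatten {suc k} s = ↔-sym +↔⊎ ↔-∘ ((↔-id _ ⊎-↔ flatten (s ∘ suc)) ↔-∘ Σ-suc)

cardinality : {A : Set} → Dec A → ℕ
cardinality (yes _) = 1
cardinality (no  _) = 0

witness : {A : Set} (d : Dec A) → Fin (cardinality d) → A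
witness (yes a) _ = a

cardinality-unique : {A : Set} (d : Dec A) (i j : Fin (cardinality d)) → i ≡ j
cardinality-unique (yes _) zero zero = refl

index : {A : Set} (d : Dec A) → A → Fin (cardinality d)
index (yes _)  _ = zero
index (no  ¬a) a = contradiction a ¬a

module _ (em : ExcludedMiddle 0ℓ) where

  comprehension : ∀ {N} → (Fin N → Set) → Subset N
  comprehension P = tabulate λ v → does (em {P v})

  ∈-comprehension⁺ : ∀ {N} {P : Fin N → Set} {v} → P v → v ∈ˢ comprehension P
  ∈-comprehension⁺ {P = P} {v} p = lookup⇒[]= v _
    (trans (lookup∘tabulate (λ w → does (em {P w})) v) (dec-true em p))

  ∈-comprehension⁻ : ∀ {N} {P : Fin N → Set} {v} → v ∈ˢ comprehension P → P v
  ∈-comprehension⁻ {P = P} {v} v∈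
    with em {P v} | trans (sym (lookup∘tabulate (λ w → does (em {P w})) v)) ([]=⇒lookup v∈)
  ... | yes p | _  = p
  ... | no  _ | ()

  -- A greedy choice along the list. It will pick one root cube for each `E`-component of a colour.
  representatives : {A : Set} (P : A → Set) (_≈_ : A → A → Set) →
    (∀ {x} → x ≈ x) → (∀ {x y} → x ≈ y → y ≈ x) →
    ∀ xs → ∃ λ ys → All P ys × AllPairs (λ x y → ¬ (x ≈ y)) ys × (∀ {x} → x ∈ xs → P x → Any (_≈ x) ys)
  representatives P _≈_ ≈-refl ≈-sym [] = [] , [] , [] , λ ()
  representatives P _≈_ ≈-refl ≈-sym (x ∷ xs)
    with representatives P _≈_ ≈-refl ≈-sym xs | em {P x}
  ... | ys , ps , ≉s , covers | no ¬px =
    ys , ps , ≉s , λ { (here refl) px → contradiction px ¬px ; (there z∈) pz → covers z∈ pz }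
  ... | ys , ps , ≉s , covers | yes px with em {Any (_≈ x) ys}
  ...   | yes covered =
    ys , ps , ≉s , λ { (here refl) _ → covered ; (there z∈) pz → covers z∈ pz }
  ...   | no  fresh   =
    x ∷ ys , px ∷ ps , All.map (λ ¬y≈x x≈y → ¬y≈x (≈-sym x≈y)) (All.¬Any⇒All¬ _ fresh) ∷ ≉s ,
    λ { (here refl) _ → here ≈-refl ; (there z∈) pz → there (covers z∈ pz) }

  module _ (Λ : OrderedGroup) where
    open OrderedGroup Λ using (Carrier; _≤_; ≤-refl; ≤-trans; ≤-total)

    argmin : {A : Set} (key : A → Carrier) (P : A → Set) (xs : List A) → Any P xs →
             ∃ λ x → P x × (∀ {y} → y ∈ xs → P y → key x ≤ key y)
    argmin key P (x ∷ xs) any with em {Any P xs} | em {P x}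
    ... | no none | _ with any
    ...   | here px   = x , px , λ { (here refl) _ → ≤-refl ; (there y∈) py → contradiction (lose y∈ py) none }
    ...   | there pxs = contradiction pxs none
    argmin key P (x ∷ xs) _ | yes pxs | d with argmin key P xs pxs
    ... | m , pm , least with d
    ...   | no ¬px = m , pm , λ { (here refl) px → contradiction px ¬px ; (there y∈) py → least y∈ py }
    ...   | yes px with ≤-total (key x) (key m)
    ...     | inj₁ x≤m = x , px , λ { (here refl) _ → ≤-refl ; (there y∈) py → ≤-trans x≤m (least y∈ py) }
    ...     | inj₂ m≤x = m , pm , λ { (here refl) _ → m≤x ; (there y∈) py → least y∈ py }

-- From a representation to forests

module Decomposition
  (em : ExcludedMiddle 0ℓ) {R : Reals} {M : Model R} (B : BoxModel M)
  {N : ℕ} (T : Graph N) (tree : IsTree T) (ρ : Representation M T)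
  where

  open Model M
  open BoxModel B
  open Representation ρ
  open Graph T
  module ℝ = RealProperties R
  open Sight B N cube

  label : Index → Fin N
  label = proj₁

  enumeration : Index ↔ Fin (total size)
  enumeration = flatten size

  elements : List Index
  elements = map (Inverse.from enumeration) (allFin (total size))

  complete : ∀ x → x ∈ elements
  complete x = subst (_∈ elements) (Inverse.strictlyInverseʳ enumeration x)
    (∈-map⁺ (Inverse.from enumeration) (∈-allFin (Inverse.to enumeration x)))

  -- The second component only breaks ties between equal heights.
  Λ : OrderedGroup
  Λ = lexicographic (additiveGroup R) ℤ-orderedGroup

  module Λ = OrderedGroup Λ

  height : Fin dim → Index → Λ.Carrier
  height i x = lo (cube x) i , ℤ.+ toℕ (Inverse.to enumeration x)

  height-injective : ∀ i {x y} → height i x Λ.≈ height i y → x ≡ y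
  height-injective i (_ , eq) = Injection.injective (↔⇒↣ enumeration) (toℕ-injective (ℤ.+-injective eq))

  rise : Fin dim → Index → Index → Λ.Carrier
  rise i x y = height i y Λ.- height i x

  Up-gap : ∀ {i x y} → Up i x y → lo (cube x) i ℝ.+ width ℝ.< lo (cube y) i
  Up-gap u = Up.lo-gap u (Up.sightway u) (disjoint _ _ (Up.distinct u))

  Up-< : ∀ {i x y} → Up i x y → lo (cube x) i ℝ.< lo (cube y) i
  Up-< u = ℝ.≤-<-trans (Beams.lo≤lo+width B _ _) (Up-gap u)

  Up-adjacent : ∀ {i x y} → Up i x y → label x ∼ label y
  Up-adjacent {x = u , a} {v , b} up with u ≟ v
  ... | no  u≢v  = Equivalence.from (adjacent u v u≢v) (a , b , Up⇒Sees up)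
  ... | yes refl = contradiction (Up⇒Sees up) (unseen u a b λ { refl → Up.distinct up refl })

  -- Along another axis the change is at most `width` by `lo-near`, and the length of the sighting
  -- exceeds `width` by `lo-gap`. Along its own axis the sighting rises by its length one way and
  -- falls the other way. Apart from the trivial equality the inequalities are strict in the real
  -- component, so the tie-breaking integers do not interfere.
  Up-steep : ∀ {i x y} → Up i x y → ∀ {j} → Sightway j →
             rise j x y Λ.≤ rise i x y × rise j y x Λ.≤ rise i x y
  Up-steep {i} {x} {y} up {j} sight with j ≟ i
  ... | yes refl = Λ.≤-refl , inj₁ (inj₁ (ℝ.<-trans
    (ℝ.<-respʳ-≈ (ℝ.-‿inverseʳ _) (ℝ.+-monoˡ-< _ (Up-< up))) (ℝ.x<y⇒0<y-x (Up-< up))))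
  ... | no j≢i with C≤A , A≤C ← Up.lo-near up sight j≢i =
    inj₁ (inj₁ (ℝ.≤-<-trans (ℝ.x≤y+z⇒x-y≤z C≤A) (ℝ.y+z<x⇒z<x-y (Up-gap up)))) ,
    inj₁ (inj₁ (ℝ.≤-<-trans (ℝ.x≤y+z⇒x-y≤z A≤C) (ℝ.y+z<x⇒z<x-y (Up-gap up))))

  Connects : Fin N → Fin N → Index → Index → Set
  Connects u v x y = (label x ≡ u × label y ≡ v) ⊎ (label x ≡ v × label y ≡ u)

  Sighting : Set
  Sighting = Fin dim × Index × Index

  Joining : Fin N → Fin N → Sighting → Set
  Joining u v (i , x , y) = Up i x y × Connects u v x y

  -- The minimum runs over sightings along all axes and in both directions. `steep` bounds the rise
  -- in both senses because a walk may cross the edge either way.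
  record Shortest (u v : Fin N) : Set where
    field
      ends     : Fin (size u) × Fin (size v)
      span     : Λ.Carrier
      sees     : Sees M {N} cube (u , proj₁ ends) (v , proj₂ ends)
      steep    : ∀ {j} → Sightway j →
                 rise j (u , proj₁ ends) (v , proj₂ ends) Λ.≤ span ×
                 rise j (v , proj₂ ends) (u , proj₁ ends) Λ.≤ span
      shortest : ∀ {i x y} → Up i x y → Connects u v x y → span Λ.≤ rise i x y

  shortest : ∀ {u v} → u ∼ v → Shortest u v
  shortest {u} {v} u∼v with a , b , sees ← Equivalence.to (adjacent u v (λ { refl → ∼-irrefl u∼v })) u∼v =
    choose (argmin em Λ (λ (i , x , y) → rise i x y) (Joining u v) sightings
      (exists (Sees⇒Up (λ { refl → ∼-irrefl u∼v }) sees)))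
    where
    sightings : List Sighting
    sightings = cartesianProduct (allFin dim) (cartesianProduct elements elements)

    listed : ∀ s → s ∈ sightings
    listed (i , x , y) = ∈-cartesianProduct⁺ (∈-allFin i) (∈-cartesianProduct⁺ (complete x) (complete y))

    exists : ∀ {a b} → (∃ λ i → Up i (u , a) (v , b) ⊎ Up i (v , b) (u , a)) → Any (Joining u v) sightings
    exists (_ , inj₁ up) = lose (listed _) (up , inj₁ (refl , refl))
    exists (_ , inj₂ up) = lose (listed _) (up , inj₂ (refl , refl))

    choose : (∃ λ s → Joining u v s × (∀ {s′} → s′ ∈ sightings → Joining u v s′ →
               rise (proj₁ s) (proj₁ (proj₂ s)) (proj₂ (proj₂ s)) Λ.≤
               rise (proj₁ s′) (proj₁ (proj₂ s′)) (proj₂ (proj₂ s′)))) → Shortest u v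
    choose ((i , (_ , a) , (_ , b)) , (up , inj₁ (refl , refl)) , least) = record
      { ends = a , b ; span = rise i (u , a) (v , b) ; sees = Up⇒Sees up
      ; steep = Up-steep up ; shortest = λ up′ c → least (listed _) (up′ , c) }
    choose ((i , (_ , b) , (_ , a)) , (up , inj₂ (refl , refl)) , least) = record
      { ends = a , b ; span = rise i (v , b) (u , a) ; sees = Sees-sym (Up⇒Sees up)
      ; steep = λ sight → swap (Up-steep up sight) ; shortest = λ up′ c → least (listed _) (up′ , c) }

  -- E joins the two ends of the shortest sighting chosen for each edge of T.
  record Chosen (x y : Index) : Set where
    constructor chosen
    field
      edge    : label x ∼ label y
      ordered : label x Fin.< label y
      isEnds  : Shortest.ends (shortest edge) ≡ (proj₂ x , proj₂ y)

  E : Index → Index → Set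
  E x y = Chosen x y ⊎ Chosen y x

  E-sym : ∀ {x y} → E x y → E y x
  E-sym = Sum.swap

  E-adjacent : ∀ {x y} → E x y → label x ∼ label y
  E-adjacent (inj₁ c) = Chosen.edge c
  E-adjacent (inj₂ c) = ∼-sym (Chosen.edge c)

  Chosen-unique : ∀ {u v a b a′ b′} → Chosen (u , a) (v , b) → Chosen (u , a′) (v , b′) → a ≡ a′ × b ≡ b′
  -- `shortest` takes a proof of adjacency; such proofs are unique, so the chosen ends depend on the
  -- edge alone.
  Chosen-unique (chosen e _ ends) (chosen e′ _ ends′) with refl ← []=-irrelevant e e′
    with refl ← trans (sym ends) ends′ = refl , refl

  E-unique : ∀ {u v a b a′ b′} → E (u , a) (v , b) → E (u , a′) (v , b′) → a ≡ a′ × b ≡ b′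
  E-unique (inj₁ c) (inj₁ c′) = Chosen-unique c c′
  E-unique (inj₂ c) (inj₂ c′) = swap (Chosen-unique c c′)
  -- An edge makes its choice only from the smaller label to the larger one, so its two orientations
  -- cannot choose differently.
  E-unique (inj₁ c) (inj₂ c′) = contradiction (Chosen.ordered c′) (ℕ.<-asym (Chosen.ordered c))
  E-unique (inj₂ c) (inj₁ c′) = contradiction (Chosen.ordered c′) (ℕ.<-asym (Chosen.ordered c))

  Chosen-sees : ∀ {x y} → Chosen x y → Sees M {N} cube x y
  Chosen-sees {u , a} {v , b} (chosen e _ refl) = Shortest.sees (shortest e)

  E-sees : ∀ {x y} → E x y → Sees M {N} cube x y
  E-sees (inj₁ c) = Chosen-sees c
  E-sees (inj₂ c) = Sees-sym (Chosen-sees c)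

  Chosen-steepest : ∀ {i x y z z′} → Chosen x y → Up i z z′ → Connects (label x) (label y) z z′ →
                    rise i x y Λ.≤ rise i z z′ × rise i y x Λ.≤ rise i z z′
  Chosen-steepest {x = u , a} {v , b} (chosen e _ refl) up connects
    with fwd , bwd ← Shortest.steep (shortest e) (Up.sightway up) =
    Λ.≤-trans fwd (Shortest.shortest (shortest e) up connects) ,
    Λ.≤-trans bwd (Shortest.shortest (shortest e) up connects)

  E-steepest : ∀ {i x y z z′} → E x y → Up i z z′ → label x ≡ label z → label y ≡ label z′ →
               rise i x y Λ.≤ rise i z z′
  E-steepest (inj₁ c) up x≡z y≡z′ = proj₁ (Chosen-steepest c up (inj₁ (sym x≡z , sym y≡z′)))
  E-steepest (inj₂ c) up x≡z y≡z′ = proj₂ (Chosen-steepest c up (inj₂ (sym x≡z , sym y≡z′)))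

  E-total : ∀ {u v} → u ∼ v → ∃₂ λ a b → E (u , a) (v , b)
  E-total {u} {v} u∼v with Fin.<-cmp u v
  ... | tri< u<v _ _ = _ , _ , inj₁ (chosen u∼v u<v refl)
  ... | tri≈ _ refl _ = contradiction u∼v ∼-irrefl
  ... | tri> _ _ v<u = _ , _ , inj₂ (chosen (∼-sym u∼v) v<u refl)

  reverse : ∀ {x y} → Star E x y → Star E y x
  reverse = Star.reverse E-sym

  module _ {t : ℕ} (size≤t : ∀ v → size v ℕ.≤ t) where

    coloured = Colouring.colouring em T tree size t size≤t E E-adjacent E-sym E-unique

    colour : Index → Fin t
    colour (v , a) = proj₁ coloured v a

    colour-E : ∀ {x y} → E x y → colour x ≡ colour y
    colour-E e = proj₂ (proj₂ coloured) e

    colour-constant : ∀ {x y} → Star E x y → colour x ≡ colour y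
    colour-constant ε        = refl
    colour-constant (e ◅ es) = trans (colour-E e) (colour-constant es)

    colour-separates : ∀ {x y} → colour x ≡ colour y → label x ≡ label y → x ≡ y
    colour-separates {u , _} {v , _} same refl = cong (u ,_) (proj₁ (proj₂ coloured) u same)

    -- The colouring settles this: it is constant along `E` and injective on the cubes of each
    -- vertex, so a component cannot return to a label with another cube.
    E-separates : ∀ {x y} → Star E x y → label x ≡ label y → x ≡ y
    E-separates s = colour-separates (colour-constant s)

    module Component (r : Index) where

      In : Fin N → Set
      In v = ∃ λ a → Star E r (v , a)

      Adj : Fin N → Fin N → Set
      Adj u v = ∃₂ λ a b → Star E r (u , a) × E (u , a) (v , b)

      component : Graph N
      component = record
        { vertices      = comprehension em In
        ; neighbourhood = λ u → comprehension em (Adj u)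
        ; ∼-sym         = λ u∼v → let a , b , s , e = ∈-comprehension⁻ em u∼v in
            ∈-comprehension⁺ em (b , a , s ◅◅ e ◅ ε , E-sym e)
        ; ∼-irrefl      = λ u∼u → let _ , _ , _ , e = ∈-comprehension⁻ em u∼u in ∼-irrefl (E-adjacent e)
        ; ∼-vertices    = λ u∼v → let a , b , s , e = ∈-comprehension⁻ em u∼v in
            ∈-comprehension⁺ em (a , s) , ∈-comprehension⁺ em (b , s ◅◅ e ◅ ε)
        }

      isTree : IsTree component
      isTree = ((label r , ∈-comprehension⁺ em (_ , ε)) , connected) , acyclic
        where
        walk : ∀ {x y} → Star E r x → Star E x y → Star (Graph._∼_ component) (label x) (label y)
        walk s ε        = ε
        walk s (e ◅ es) = ∈-comprehension⁺ em (_ , _ , s , e) ◅ walk (s ◅◅ e ◅ ε) es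

        connected : ∀ u v → u ∈ˢ comprehension em In → v ∈ˢ comprehension em In →
                    Star (Graph._∼_ component) u v
        connected u v u∈ v∈ with a , ru ← ∈-comprehension⁻ em u∈ | b , rv ← ∈-comprehension⁻ em v∈ =
          walk ru (reverse ru ◅◅ rv)

        embed : ∀ {u v} → Graph._∼_ component u v → u ∼ v
        embed u∼v = let _ , _ , _ , e = ∈-comprehension⁻ em u∼v in E-adjacent e

        acyclic : ¬ Cycle component
        acyclic c = proj₂ tree record
          { vertex    = Cycle.vertex c
          ; injective = Cycle.injective c
          ; step      = embed ∘ Cycle.step c
          ; close     = embed (Cycle.close c)
          }

      size′ : Fin N → ℕ
      size′ v = cardinality (em {In v})

      Index′ : Set
      Index′ = Σ (Fin N) (Fin ∘ size′)

      φ : Index′ → Index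
      φ (v , a) = v , proj₁ (witness (em {In v}) a)

      reached : ∀ x → Star E r (φ x)
      reached (v , a) = proj₂ (witness (em {In v}) a)

      unique : ∀ {v} (a b : Fin (size′ v)) → a ≡ b
      unique {v} = cardinality-unique (em {In v})

      φ-injective : ∀ {x y} → φ x ≡ φ y → x ≡ y
      φ-injective {u , a} {v , b} eq with refl ← cong proj₁ eq = cong (u ,_) (unique a b)

      -- For each vertex `em` picks some cube in the component; by `E-separates` there is only one
      -- to pick.
      φ-onto : ∀ {x} → Star E r x → ∃ λ a → φ (label x , a) ≡ x
      φ-onto {v , a} s = i , E-separates (reverse (reached (v , i)) ◅◅ s) refl
        where i = index (em {In v}) (a , s)

      restrict : ∀ {x y} → Sees M {N} cube (φ x) (φ y) → Sees M {N} (cube ∘ φ) x y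
      restrict (i , sight , K , joins , clear) =
        i , sight , K , joins , λ z z≢x z≢y → clear (φ z) (z≢x ∘ φ-injective) (z≢y ∘ φ-injective)

      Adj⇒Sees : ∀ {u v} → Adj u v → ∃₂ λ a b → Sees M {N} (cube ∘ φ) (u , a) (v , b)
      Adj⇒Sees (_ , _ , s , e) with i , eq ← φ-onto s | j , eq′ ← φ-onto (s ◅◅ e ◅ ε) =
        i , j , restrict (subst₂ (Sees M {N} cube) (sym eq) (sym eq′) (E-sees e))

      module Sight′ = Sight B N (cube ∘ φ)

      -- In the full family other cubes may stand in the beam, and `beamChain` walks through such
      -- cubes. By `firstStep` the first step of this walk is an `E`-edge, so it ends in the
      -- component. Unless it ends at `φ y`, it ends at a cube of the component standing in the
      -- beam, against `up.clear`.
      Up′⇒E : ∀ {i x y} → Sight′.Up i x y → E (φ x) (φ y)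
      Up′⇒E {i} {x} {y} up = conclude
        (A.firstStep (reverse (reached x) ◅◅ reached y) φx≢φy
          (beamChain em elements complete disjoint φx≢φy up.sightway up.beam))
        where
        module up = Sight′.Up up
        φx≢φy : φ x ≢ φ y
        φx≢φy = up.distinct ∘ φ-injective

        Hit : Index → Set
        Hit z = z ≢ φ y → Hits em elements complete disjoint up.beam z

        module A = Ascent T (proj₂ tree) (λ _ _ → em) label Λ (height i) (height-injective i)
          (λ w z → Up i w z × Hit z) E (Up-adjacent ∘ proj₁) (inj₁ ∘ Up-< ∘ proj₁) E-adjacent
          (λ e u → E-steepest e (proj₁ u)) E-separates

        conclude : (∃ λ z → E (φ x) z × (Up i (φ x) z × Hit z) × _) → E (φ x) (φ y)
        conclude (z , e , (u , hit) , _) with em {z ≡ φ y}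
        ... | yes refl = e
        ... | no  z≢φy with c , φc≡z ← φ-onto (reached x ◅◅ e ◅ ε) =
          contradiction (subst (λ w → region (cube w) _) (sym φc≡z) (proj₂ (proj₂ (hit z≢φy))))
            λ p∈ → up.clear (_ , c)
              (λ { refl → Up.distinct u φc≡z })
              (λ { refl → z≢φy (sym φc≡z) })
              _ (proj₁ (proj₂ (hit z≢φy)) , p∈)

      isVisible : IsVisibilityGraph M component
      isVisible = record
        { size     = size′
        ; cube     = cube ∘ φ
        ; assigned = λ v → mk⇔
            (λ v∈ → ℕ.≤-<-trans z≤n (Fin.toℕ<n (index (em {In v}) (∈-comprehension⁻ em v∈))))
            (λ 0<s → ∈-comprehension⁺ em (witness (em {In v}) (fromℕ< 0<s)))
        ; disjoint = λ x y x≢y → disjoint (φ x) (φ y) (x≢y ∘ φ-injective)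
        ; adjacent = λ u v u≢v → mk⇔
            (λ u∼v → Adj⇒Sees (∈-comprehension⁻ em u∼v))
            (λ (a , b , sees) → ∈-comprehension⁺ em
              (_ , _ , reached (u , a) , fromUp (Sight′.Sees⇒Up (λ { refl → u≢v refl }) sees)))
        ; unseen   = λ v a b a≢b → contradiction (unique a b) a≢b
        } , λ v v∈ → one v (∈-comprehension⁻ em v∈)
        where
        fromUp : ∀ {x y} → (∃ λ i → Sight′.Up i x y ⊎ Sight′.Up i y x) → E (φ x) (φ y)
        fromUp (_ , inj₁ up) = Up′⇒E up
        fromUp (_ , inj₂ up) = E-sym (Up′⇒E up)

        one : ∀ v → In v → size′ v ≡ 1
        one v v∈ with em {In v}
        ... | yes _ = refl
        ... | no  v∉ = contradiction v∈ v∉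

    open Component using (component)

    module ColourClass (c : Fin t) where

      Coloured : Fin N → Set
      Coloured v = ∃ λ a → colour (v , a) ≡ c

      Adj : Fin N → Fin N → Set
      Adj u v = ∃₂ λ a b → colour (u , a) ≡ c × E (u , a) (v , b)

      colourClass : Graph N
      colourClass = record
        { vertices      = comprehension em Coloured
        ; neighbourhood = λ u → comprehension em (Adj u)
        ; ∼-sym         = λ u∼v → let a , b , s , e = ∈-comprehension⁻ em u∼v in
            ∈-comprehension⁺ em (b , a , trans (sym (colour-E e)) s , E-sym e)
        ; ∼-irrefl      = λ u∼u → let _ , _ , _ , e = ∈-comprehension⁻ em u∼u in ∼-irrefl (E-adjacent e)
        ; ∼-vertices    = λ u∼v → let a , b , s , e = ∈-comprehension⁻ em u∼v in
            ∈-comprehension⁺ em (a , s) , ∈-comprehension⁺ em (b , trans (sym (colour-E e)) s)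
        }

      roots = representatives em (λ x → colour x ≡ c) (Star E) ε reverse elements

      root : Fin (length (proj₁ roots)) → Index
      root = lookup (proj₁ roots)

      root-colour : ∀ i → colour (root i) ≡ c
      root-colour i = All.lookup (proj₁ (proj₂ roots)) (∈-lookup i)

      rooted : ∀ {x} → colour x ≡ c → ∃ λ i → Star E (root i) x
      rooted x≡c = let p = proj₂ (proj₂ (proj₂ roots)) (complete _) x≡c in Any.index p , lookup-index p

      isForest : IsVisibilityForest M colourClass
      isForest = length (proj₁ roots) , component ∘ root ,
        (λ i → Component.isTree (root i) , Component.isVisible (root i)) ,
        vertexDisjoint , unionVertices , unionEdges
        where
        vertexDisjoint : VertexDisjoint (component ∘ root)
        vertexDisjoint i j i≢j v v∈i v∈j
          with a , si ← ∈-comprehension⁻ em v∈i | b , sj ← ∈-comprehension⁻ em v∈j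
          -- Both cubes of `v` have colour `c`, so they coincide and would connect two distinct
          -- representatives.
          with refl ← colour-separates {v , a} {v , b}
            (trans (sym (colour-constant si)) (trans (root-colour i)
              (trans (sym (root-colour j)) (colour-constant sj)))) refl =
          AllPairs-lookup (λ ¬s → ¬s ∘ reverse) (proj₁ (proj₂ (proj₂ roots))) i≢j (si ◅◅ reverse sj)

        unionVertices : ∀ v → v ∈ˢ comprehension em Coloured ⇔
                        (∃ λ i → v ∈ˢ Graph.vertices (component (root i)))
        unionVertices v = mk⇔ to from
          where
          to : v ∈ˢ comprehension em Coloured → _
          to v∈ with a , v≡c ← ∈-comprehension⁻ em v∈ with i , s ← rooted v≡c =
            i , ∈-comprehension⁺ em (a , s)
          from : (∃ λ i → v ∈ˢ Graph.vertices (component (root i))) → _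
          from (i , v∈) with a , s ← ∈-comprehension⁻ em v∈ =
            ∈-comprehension⁺ em (a , trans (sym (colour-constant s)) (root-colour i))

        unionEdges : ∀ u v → Graph._∼_ colourClass u v ⇔ (∃ λ i → Graph._∼_ (component (root i)) u v)
        unionEdges u v = mk⇔ to from
          where
          to : Graph._∼_ colourClass u v → _
          to u∼v with a , b , u≡c , e ← ∈-comprehension⁻ em u∼v with i , s ← rooted u≡c =
            i , ∈-comprehension⁺ em (a , b , s , e)
          from : (∃ λ i → Graph._∼_ (component (root i)) u v) → _
          from (i , u∼v) with a , b , s , e ← ∈-comprehension⁻ em u∼v =
            ∈-comprehension⁺ em (a , b , trans (sym (colour-constant s)) (root-colour i) , e)

    open ColourClass using (colourClass)

    decomposable : ForestDecomposable M T t
    decomposable = colourClass , ColourClass.isForest , unionVertices , unionEdges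
      where
      unionVertices : ∀ v → v ∈ˢ vertices ⇔ (∃ λ c → v ∈ˢ Graph.vertices (colourClass c))
      unionVertices v = mk⇔ to from
        where
        to : v ∈ˢ vertices → _
        to v∈ = colour (v , a) , ∈-comprehension⁺ em (a , refl)
          where a = fromℕ< (Equivalence.to (assigned v) v∈)
        from : (∃ λ c → v ∈ˢ Graph.vertices (colourClass c)) → _
        from (c , v∈) with a , _ ← ∈-comprehension⁻ em v∈ =
          Equivalence.from (assigned v) (ℕ.≤-<-trans z≤n (Fin.toℕ<n a))

      unionEdges : ∀ u v → u ∼ v ⇔ (∃ λ c → Graph._∼_ (colourClass c) u v)
      unionEdges u v = mk⇔ to from
        where
        to : u ∼ v → _
        to u∼v with a , b , e ← E-total u∼v = colour (u , a) , ∈-comprehension⁺ em (a , b , refl , e)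
        from : (∃ λ c → Graph._∼_ (colourClass c) u v) → _
        from (c , u∼v) with _ , _ , _ , e ← ∈-comprehension⁻ em u∼v = E-adjacent e

-- From forests to a representation

module Translation {R : Reals} where

  open RealProperties R

  infixl 6 _⊕_ _⊖_

  _⊕_ _⊖_ : ∀ {m} → Vector ℝ m → ℝ → Vector ℝ m
  (p ⊕ s) j = p j + s
  (p ⊖ s) j = p j - s

  x+s≤y⇒x≤y-s : ∀ {x y} s → x + s ≤ y → x ≤ y - s
  x+s≤y⇒x≤y-s {x} s p = ≤-respˡ-≈ (x+y-y≈x x s) (+-monoˡ-≤ (- s) p)

  y≤x+s⇒y-s≤x : ∀ {x y} s → y ≤ x + s → y - s ≤ x
  y≤x+s⇒y-s≤x {x} s p = ≤-respʳ-≈ (x+y-y≈x x s) (+-monoˡ-≤ (- s) p)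

  x≤y-s⇒x+s≤y : ∀ {x y} s → x ≤ y - s → x + s ≤ y
  x≤y-s⇒x+s≤y {x} {y} s p = ≤-respʳ-≈ (x-y+y≈x y s) (+-monoˡ-≤ s p)

  y-s≤x⇒y≤x+s : ∀ {x y} s → y - s ≤ x → y ≤ x + s
  y-s≤x⇒y≤x+s {x} {y} s p = ≤-respˡ-≈ (x-y+y≈x y s) (+-monoˡ-≤ s p)

  module _ {m : ℕ} {axis : Fin m} (K : Channel R axis) (s : ℝ) where

    private
      module K = Channel K

      regroup : ∀ x c → x - (c + s) ≈ (x - s) - c
      regroup x c = ≈-trans (+-congˡ (≈-trans (≈-sym (-‿+-comm c s)) (+-comm (- c) (- s))))
        (≈-sym (+-assoc x (- s) (- c)))

      translate-dist² : ∀ p → dist² R axis p (K.centre ⊕ s) ≈ dist² R axis (p ⊖ s) K.centre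
      translate-dist² p = dist²-cong axis λ j _ → regroup (p j) (K.centre j)

      untranslate : ∀ {p} → K.CrossSection p → dist² R axis (p ⊕ s) (K.centre ⊕ s) ≤ K.radius * K.radius
      untranslate {p} = ≤-respˡ-≈ (≈-sym (≈-trans (translate-dist² (p ⊕ s))
        (dist²-cong axis λ j _ → +-congʳ (x+y-y≈x (p j) s))))

    translate : Channel R axis
    translate = record
      { centre = K.centre ⊕ s ; radius = K.radius
      ; start = K.start + s ; finish = K.finish + s
      ; 0≤radius = K.0≤radius
      ; start<finish = +-monoˡ-< s K.start<finish
      ; positiveDiameter = let p , q , p∈ , q∈ , j , j≢axis , p≉q = K.positiveDiameter in
          p ⊕ s , q ⊕ s , untranslate p∈ , untranslate q∈ , j , j≢axis ,
          λ eq → p≉q (≈-trans (≈-sym (x+y-y≈x (p j) s)) (≈-trans (+-congʳ eq) (x+y-y≈x (q j) s)))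
      }

    private module K⁺ = Channel translate

    translate-CrossSection : ∀ {p} → K⁺.CrossSection p → K.CrossSection (p ⊖ s)
    translate-CrossSection {p} = ≤-respˡ-≈ (translate-dist² p)

    translate-StartFace : ∀ {p} → K⁺.StartFace p → K.StartFace (p ⊖ s)
    translate-StartFace (p∈ , p≈) = translate-CrossSection p∈ , ≈-trans (+-congʳ p≈) (x+y-y≈x K.start s)

    translate-FinishFace : ∀ {p} → K⁺.FinishFace p → K.FinishFace (p ⊖ s)
    translate-FinishFace (p∈ , p≈) = translate-CrossSection p∈ , ≈-trans (+-congʳ p≈) (x+y-y≈x K.finish s)

    translate-Cylinder : ∀ {p} → K⁺.Cylinder p → K.Cylinder (p ⊖ s)
    translate-Cylinder (p∈ , start≤ , ≤finish) =
      translate-CrossSection p∈ , x+s≤y⇒x≤y-s s start≤ , y≤x+s⇒y-s≤x s ≤finish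

  module _ {M : Model R} (B : BoxModel M) where
    open Model M
    open BoxModel B

    region-cong : ∀ {A p q} → (∀ j → p j ≈ q j) → region A p → region A q
    region-cong p≈q p∈ = box⇒region λ j → let l , h = region⇒box p∈ j in
      ≤-respʳ-≈ (p≈q j) l , ≤-respˡ-≈ (p≈q j) h

    region-shift⁺ : ∀ {A p} s → region A (p ⊖ s) → region (shift s A) p
    region-shift⁺ {A} s p∈ = box⇒region λ j → let l , h = region⇒box p∈ j in
      ≤-respˡ-≈ (≈-sym (lo-shift s A j)) (x≤y-s⇒x+s≤y s l) ,
      ≤-respʳ-≈ (≈-sym (hi-shift s A j)) (y-s≤x⇒y≤x+s s h)

    region-shift⁻ : ∀ {A p} s → region (shift s A) p → region A (p ⊖ s)
    region-shift⁻ {A} s p∈ = box⇒region λ j → let l , h = region⇒box p∈ j in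
      x+s≤y⇒x≤y-s s (≤-respˡ-≈ (lo-shift s A j) l) , y≤x+s⇒y-s≤x s (≤-respʳ-≈ (hi-shift s A j) h)

    -- A channel between placed cubes is moved back by `- s`, and its points are tested at
    -- `p ⊖ - s`; the double negation cancels against the shift of the cube.
    region-unshift⁻ : ∀ {A p} s → region (shift s A) (p ⊖ - s) → region A p
    region-unshift⁻ {A} {p} s p∈ =
      region-cong (λ j → ≈-trans (+-congʳ (+-congˡ (-‿involutive s))) (x+y-y≈x (p j) s)) (region-shift⁻ s p∈)

    region-unshift⁺ : ∀ {A p} s → region A p → region (shift s A) (p ⊖ - s)
    region-unshift⁺ {A} {p} s p∈ = region-shift⁺ s
      (region-cong (λ j → ≈-sym (≈-trans (+-congʳ (+-congˡ (-‿involutive s))) (x+y-y≈x (p j) s))) p∈)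

module Bounds (R : Reals) where

  open RealProperties R using (ℝ; 0#; _≤_; ≤-refl; ≤-trans; ≤-total)

  -- Zero bounds the empty family, and nonnegative bounds make `step` nonnegative.
  Bounded : Set → Set
  Bounded A = ∀ (f : A → ℝ) → ∃ λ b → 0# ≤ b × ∀ a → f a ≤ b

  bounded-Fin : ∀ m → Bounded (Fin m)
  bounded-Fin zero    f = 0# , ≤-refl , λ ()
  bounded-Fin (suc m) f with b , 0≤b , f≤b ← bounded-Fin m (f ∘ suc) with ≤-total (f zero) b
  ... | inj₁ f₀≤b = b , 0≤b , λ { zero → f₀≤b ; (suc j) → f≤b j }
  ... | inj₂ b≤f₀ = f zero , ≤-trans 0≤b b≤f₀ , λ { zero → ≤-refl ; (suc j) → ≤-trans (f≤b j) b≤f₀ }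

  bounded-Σ : ∀ {k} {C : Fin k → Set} → (∀ i → Bounded (C i)) → Bounded (Σ (Fin k) C)
  bounded-Σ {k} bounded f with bounded-Fin k (λ i → proj₁ (bounded i (λ c → f (i , c))))
  ... | b , 0≤b , ≤b = b , 0≤b , λ (i , c) → ≤-trans (proj₂ (proj₂ (bounded i (λ c → f (i , c)))) c) (≤b i)

module UnionRepresentation
  {R : Reals} {M : Model R} (B : BoxModel M) {N k : ℕ}
  (H : Fin k → Graph N) (ρ : ∀ i → Representation M (H i)) {G : Graph N} (union : IsUnion H G)
  where

  open Model M
  open BoxModel B
  open RealProperties R
  open Translation {R}
  open Bounds R
  module ρ i = Representation (ρ i)

  Piece : Set
  Piece = Σ (Fin k) λ i → ρ.Index i

  original : Piece → Cube
  original (i , x) = ρ.cube i x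

  pieces-bounded : Bounded (Fin dim × Piece)
  pieces-bounded = bounded-Σ λ _ → bounded-Σ λ i → bounded-Σ λ v → bounded-Fin (ρ.size i v)

  top : ∃ λ b → 0# ≤ b × ∀ ((j , x) : Fin dim × Piece) → hi (original x) j ≤ b
  top = pieces-bounded λ (j , x) → hi (original x) j

  bottom : ∃ λ b → 0# ≤ b × ∀ ((j , x) : Fin dim × Piece) → - lo (original x) j ≤ b
  bottom = pieces-bounded λ (j , x) → - lo (original x) j

  -- Upper coordinates are at most `top` and lower ones at least minus `bottom`, so a translation by
  -- their sum lifts every lower face to the highest upper face or above it. The 1 makes the gap
  -- strict.
  step : ℝ
  step = proj₁ top + proj₁ bottom + 1#

  0≤step : 0# ≤ step
  0≤step = ≤-respˡ-≈ (≈-trans (+-congʳ (+-identityˡ 0#)) (+-identityˡ 0#))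
    (+-mono-≤ (+-mono-≤ (proj₁ (proj₂ top)) (proj₁ (proj₂ bottom))) (inj₁ 0<1))

  offset : ℕ → ℝ
  offset zero    = 0#
  offset (suc n) = offset n + step

  offset-mono : ∀ {m n} → m ℕ.≤′ n → offset m ≤ offset n
  offset-mono ℕ.≤′-refl     = ≤-refl
  offset-mono (ℕ.≤′-step p) = ≤-trans (offset-mono p) (≤-respˡ-≈ (+-identityʳ _) (+-monoʳ-≤ _ 0≤step))

  placed : Piece → Cube
  placed x = shift (offset (toℕ (proj₁ x))) (original x)

  placed-apart : ∀ x y j → toℕ (proj₁ x) ℕ.< toℕ (proj₁ y) → hi (placed x) j < lo (placed y) j
  placed-apart x y j i<i′ = <-respˡ-≈ (≈-sym (hi-shift _ _ j)) (<-respʳ-≈ (≈-sym (lo-shift _ _ j))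
    (≤-<-trans (+-monoˡ-≤ o (proj₂ (proj₂ top) (j , x)))
      (<-≤-trans gap (+-monoʳ-≤ _ (offset-mono (ℕ.≤⇒≤′ i<i′))))))
    where
    o = offset (toℕ (proj₁ x))
    t = proj₁ top
    b = proj₁ bottom
    l = lo (original y) j
    0≤l+b : 0# ≤ l + b
    0≤l+b = ≤-respˡ-≈ (-‿inverseʳ l) (+-monoʳ-≤ l (proj₂ (proj₂ bottom) (j , y)))
    t<l+step : t < l + step
    t<l+step = <-respʳ-≈ rearrange (<-respˡ-≈ (+-identityʳ t) (+-monoʳ-< t
      (≤-<-trans 0≤l+b (<-respˡ-≈ (+-identityʳ _) (+-monoʳ-< (l + b) 0<1)))))
      where
      rearrange : t + (l + b + 1#) ≈ l + step
      rearrange = ≈-trans (≈-sym (+-assoc t (l + b) 1#)) (≈-trans (+-congʳ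
        (≈-trans (≈-sym (+-assoc t l b)) (≈-trans (+-congʳ (+-comm t l)) (+-assoc l t b))))
        (+-assoc l (t + b) 1#))
    gap : t + o < l + (o + step)
    gap = <-respʳ-≈ (≈-trans (+-assoc l step o) (+-congˡ (+-comm step o))) (+-monoˡ-< o t<l+step)

  -- The diagonal translation separates the pieces in every coordinate at once, so one shared value
  -- identifies the piece and any transverse axis of a channel will do.
  same-piece : ∀ x y j {t} → lo (placed x) j ≤ t × t ≤ hi (placed x) j →
               lo (placed y) j ≤ t × t ≤ hi (placed y) j → proj₁ x ≡ proj₁ y
  same-piece x y j (lx , hx) (ly , hy) with ℕ.<-cmp (toℕ (proj₁ x)) (toℕ (proj₁ y))
  ... | tri< x<y _ _ = contradiction (≤-trans ly hx) (<⇒≱ (placed-apart x y j x<y))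
  ... | tri≈ _ x≡y _ = toℕ-injective x≡y
  ... | tri> _ _ y<x = contradiction (≤-trans lx hy) (<⇒≱ (placed-apart y x j y<x))

  placed-disjoint : ∀ x y → x ≢ y → Disjoint R (region (placed x)) (region (placed y))
  placed-disjoint (i , x) (i′ , y) x≢y p (p∈x , p∈y)
    with refl ← same-piece (i , x) (i′ , y) anAxis (region⇒box p∈x anAxis) (region⇒box p∈y anAxis) =
    ρ.disjoint i x y (λ { refl → x≢y refl }) _ (region-shift⁻ B _ p∈x , region-shift⁻ B _ p∈y)

  module Placed = Sight B N placed
  module Original i = Sight B N (ρ.cube i)

  place : ∀ {a i x y} → Original.Up i a x y → Placed.Up a (i , x) (i , y)
  place {a} {i} {x} {y} up = record
    { distinct = λ { refl → up.distinct refl }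
    ; sightway = up.sightway
    ; beam     = record
      { channel = translate up.channel s
      ; start⊆  = λ p p∈ → region-shift⁺ B s (up.start⊆ _ (translate-StartFace up.channel s p∈))
      ; finish⊆ = λ p p∈ → region-shift⁺ B s (up.finish⊆ _ (translate-FinishFace up.channel s p∈))
      }
    ; clear    = clear
    }
    where
    module up = Original.Up i up
    s = offset (toℕ i)
    clear : ∀ z → z ≢ (i , x) → z ≢ (i , y) →
            Disjoint R (Channel.Cylinder (translate up.channel s)) (region (placed z))
    -- A cube hit by the channel shares with the start cube the transverse coordinate of the point
    -- hit, so it belongs to the same piece.
    clear (i′ , z) z≢x z≢y p (p∈ , p∈z) with j , j≢a ← up.transverse
      with l , h ← up.shadesˢ (translate-CrossSection up.channel s (proj₁ p∈)) j j≢a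
      with refl ← same-piece (i , x) (i′ , z) j
        (≤-respˡ-≈ (≈-sym (lo-shift s _ j)) (x≤y-s⇒x+s≤y s l) ,
         ≤-respʳ-≈ (≈-sym (hi-shift s _ j)) (y-s≤x⇒y≤x+s s h))
        (region⇒box p∈z j) =
      up.clear z (λ { refl → z≢x refl }) (λ { refl → z≢y refl }) _
        (translate-Cylinder up.channel s p∈ , region-shift⁻ B s p∈z)

  -- An inductive family, so that matching on it identifies the pieces of the two cubes.
  data Within : Piece → Piece → Set where
    within : ∀ {i x y} → Sees M {N} (ρ.cube i) x y → Within (i , x) (i , y)

  Within-sym : ∀ {x y} → Within x y → Within y x
  Within-sym (within s) = within (Original.Sees-sym _ s)

  -- Both ends shade the centre of the channel, so they share its transverse coordinate and come
  -- from one piece.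
  unplace : ∀ {a x y} → Placed.Up a x y → Within x y
  unplace {a} {i , x} {i′ , y} up with j , j≢a ← Placed.Up.transverse up
    with refl ← same-piece (i , x) (i′ , y) j
      (Placed.Up.shadesˢ up (Placed.Up.centre-CrossSection up) j j≢a)
      (Placed.Up.shadesᶠ up (Placed.Up.centre-CrossSection up) j j≢a) = within (Original.Up⇒Sees i record
    { distinct = λ { refl → up.distinct refl }
    ; sightway = up.sightway
    ; beam     = record
      { channel = translate up.channel (- s)
      ; start⊆  = λ p p∈ → region-unshift⁻ B s (up.start⊆ _ (translate-StartFace up.channel (- s) p∈))
      ; finish⊆ = λ p p∈ → region-unshift⁻ B s (up.finish⊆ _ (translate-FinishFace up.channel (- s) p∈))
      }
    ; clear    = λ z z≢x z≢y p (p∈ , p∈z) → up.clear (i , z) (λ { refl → z≢x refl }) (λ { refl → z≢y refl }) _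
        (translate-Cylinder up.channel (- s) p∈ , region-unshift⁺ B s p∈z)
    })
    where
    module up = Placed.Up up
    s = offset (toℕ i)

  size : Fin N → ℕ
  size v = total λ i → ρ.size i v

  decode : Σ (Fin N) (Fin ∘ size) → Piece
  decode (v , a) = let i , b = Inverse.from (flatten (λ i → ρ.size i v)) a in i , v , b

  encode : Piece → Σ (Fin N) (Fin ∘ size)
  encode (i , v , b) = v , Inverse.to (flatten (λ i → ρ.size i v)) (i , b)

  decode-encode : ∀ x → decode (encode x) ≡ x
  decode-encode (i , v , b) = cong (λ (i , b) → i , v , b)
    (Inverse.strictlyInverseʳ (flatten (λ i → ρ.size i v)) (i , b))

  encode-decode : ∀ x → encode (decode x) ≡ x
  encode-decode (v , a) = cong (v ,_) (Inverse.strictlyInverseˡ (flatten (λ i → ρ.size i v)) a)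

  decode-injective : ∀ {x y} → decode x ≡ decode y → x ≡ y
  decode-injective {x} {y} eq = trans (sym (encode-decode x)) (trans (cong encode eq) (encode-decode y))

  ⇒Sees : ∀ {x y} → Sees M {N} placed x y → Sees M {N} (placed ∘ decode) (encode x) (encode y)
  ⇒Sees {x} {y} s with a , sight , K , joins , clear ←
    subst₂ (Sees M {N} placed) (sym (decode-encode x)) (sym (decode-encode y)) s =
    a , sight , K , joins , λ z z≢x z≢y → clear (decode z) (z≢x ∘ decode-injective) (z≢y ∘ decode-injective)

  Sees⇒ : ∀ {x y} → Sees M {N} (placed ∘ decode) x y → Sees M {N} placed (decode x) (decode y)
  Sees⇒ (a , sight , K , joins , clear) = a , sight , K , joins , λ z z≢x z≢y →
    subst (λ w → Disjoint R (Channel.Cylinder K) (region (placed w))) (decode-encode z)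
      (clear (encode z) (λ { refl → z≢x (sym (decode-encode z)) }) (λ { refl → z≢y (sym (decode-encode z)) }))

  unplace-Sees : ∀ {x y} → x ≢ y → Sees M {N} (placed ∘ decode) x y → Within (decode x) (decode y)
  unplace-Sees x≢y s with Placed.Sees⇒Up (x≢y ∘ decode-injective) (Sees⇒ s)
  ... | _ , inj₁ up = unplace up
  ... | _ , inj₂ up = Within-sym (unplace up)

  place-Sees : ∀ {i x y} → x ≢ y → Sees M {N} (ρ.cube i) x y → Sees M {N} placed (i , x) (i , y)
  place-Sees {i} x≢y s with Original.Sees⇒Up i x≢y s
  ... | _ , inj₁ up = Placed.Up⇒Sees (place up)
  ... | _ , inj₂ up = Placed.Sees-sym (Placed.Up⇒Sees (place up))

  representation : Representation M G
  representation = record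
    { size     = size
    ; cube     = placed ∘ decode
    ; assigned = λ v → mk⇔ (assigned⇒ v) (assigned⇐ v)
    ; disjoint = λ x y x≢y → placed-disjoint (decode x) (decode y) (x≢y ∘ decode-injective)
    ; adjacent = λ u v u≢v → mk⇔ (adjacent⇒ u≢v) (adjacent⇐ u≢v)
    ; unseen   = unseen
    }
    where
    open Graph G
    assigned⇒ : ∀ v → v ∈ˢ vertices → 0 ℕ.< size v
    assigned⇒ v v∈ with i , v∈i ← Equivalence.to (proj₁ union v) v∈ =
      ℕ.≤-<-trans z≤n (Fin.toℕ<n (Inverse.to (flatten (λ i → ρ.size i v))
        (i , fromℕ< (Equivalence.to (ρ.assigned i v) v∈i))))

    assigned⇐ : ∀ v → 0 ℕ.< size v → v ∈ˢ vertices
    assigned⇐ v 0<s with i , b ← Inverse.from (flatten (λ i → ρ.size i v)) (fromℕ< 0<s) =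
      Equivalence.from (proj₁ union v) (i , Equivalence.from (ρ.assigned i v) (ℕ.≤-<-trans z≤n (Fin.toℕ<n b)))

    adjacent⇒ : ∀ {u v} → u ≢ v → u ∼ v → ∃₂ λ a b → Sees M {N} (placed ∘ decode) (u , a) (v , b)
    adjacent⇒ {u} {v} u≢v u∼v with i , u∼ᵢv ← Equivalence.to (proj₂ union u v) u∼v
      with a , b , s ← Equivalence.to (ρ.adjacent i u v u≢v) u∼ᵢv =
      _ , _ , ⇒Sees (place-Sees (λ { refl → u≢v refl }) s)

    adjacent⇐ : ∀ {u v} → u ≢ v → (∃₂ λ a b → Sees M {N} (placed ∘ decode) (u , a) (v , b)) → u ∼ v
    adjacent⇐ {u} {v} u≢v (a , b , s) = conclude (unplace-Sees (λ { refl → u≢v refl }) s)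
      where
      conclude : ∀ {i i′ a b} → Within (i , u , a) (i′ , v , b) → u ∼ v
      conclude (within {i} s) = Equivalence.from (proj₂ union u v)
        (i , Equivalence.from (ρ.adjacent i u v u≢v) (_ , _ , s))

    unseen : ∀ v a b → a ≢ b → ¬ Sees M {N} (placed ∘ decode) (v , a) (v , b)
    unseen v a b a≢b s = conclude (unplace-Sees va≢vb s) (va≢vb ∘ decode-injective)
      where
      va≢vb : (v , a) ≢ (v , b)
      va≢vb refl = a≢b refl
      conclude : ∀ {i i′ a b} → Within (i , v , a) (i′ , v , b) → (i , v , a) ≢ (i′ , v , b) → ⊥
      conclude (within {i} s) distinct = ρ.unseen i v _ _ (λ { refl → distinct refl }) s

-- The two models

standardBoxes : (R : Reals) (n : ℕ) → BoxModel (standard R (suc n))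
standardBoxes R n = record
  { lo          = λ a → a
  ; hi          = λ a j → a j + 1#
  ; region⇒box  = λ p∈ → p∈
  ; box⇒region  = λ p∈ → p∈
  ; width       = 1#
  ; 0≤width     = inj₁ 0<1
  ; hi≈lo+width = λ _ _ → ≈-refl
  ; shift       = λ s a j → a j + s
  ; lo-shift    = λ _ _ _ → ≈-refl
  ; hi-shift    = λ s a j → swap-last (a j) s 1#
  ; anAxis      = zero
  }
  where
  open RealProperties R

  swap-last : ∀ x y z → x + y + z ≈ x + z + y
  swap-last x y z = ≈-trans (+-assoc x y z) (≈-trans (+-congˡ (+-comm y z)) (≈-sym (+-assoc x z y)))

orthogonalBoxes : (R : Reals) (n : ℕ) → BoxModel (orthogonal R n)
orthogonalBoxes R n = record
  { lo          = λ (a , c) j → extend a c (view j)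
  ; hi          = λ (a , c) j → extend (λ i → a i + 1#) c (view j)
  ; region⇒box  = λ {A} {p} p∈ j → region⇒ {A} {p} p∈ (view j)
  ; box⇒region  = λ {A} {p} → ⇒region {A} {p}
  -- A cube is flat along the only axis of sight.
  ; width       = 0#
  ; 0≤width     = ≤-refl
  ; hi≈lo+width = hi≈lo
  ; shift       = λ s (a , c) → (λ i → a i + s) , c + s
  ; lo-shift    = λ s (a , c) j → lo-shift s a c (view j)
  ; hi-shift    = λ s (a , c) j → hi-shift s a c (view j)
  ; anAxis      = zero
  }
  where
  open RealProperties R
  open Model (orthogonal R n) using (Cube; region; Sightway)

  -- The last coordinate is treated as an interval of length zero, which turns the equation of the
  -- hyperplane into a pair of bounds.
  extend : ∀ {j} → Vector ℝ n → ℝ → View {suc n} j → ℝ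
  extend a c ‵fromℕ       = c
  extend a c (‵inject₁ i) = a i

  Slab : Cube → Vector ℝ (suc n) → ∀ {j} → View j → Set
  Slab (a , c) p {j} v = extend a c v ≤ p j × p j ≤ extend (λ i → a i + 1#) c v

  region⇒ : ∀ {A p} → region A p → ∀ {j} (v : View j) → Slab A p v
  region⇒ (_ , p≈c) ‵fromℕ       = inj₂ (≈-sym p≈c) , inj₂ p≈c
  region⇒ (box , _) (‵inject₁ i) = box i

  ⇒region : ∀ {A p} → (∀ j → Slab A p (view j)) → region A p
  ⇒region {A} {p} box =
    (λ i → subst (Slab A p) (view-inject₁ i) (box (inject₁ i))) ,
    (let l , h = subst (Slab A p) (view-fromℕ n) (box (fromℕ n)) in ≤-antisym h l)

  hi≈lo : ∀ ((a , c) : Cube) {i} → Sightway i →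
          extend (λ j → a j + 1#) c (view i) ≈ extend a c (view i) + 0#
  hi≈lo (a , c) refl = subst (λ v → extend (λ j → a j + 1#) c v ≈ extend a c v + 0#)
    (sym (view-fromℕ n)) (≈-sym (+-identityʳ c))

  lo-shift : ∀ s a c {j} (v : View j) → extend (λ i → a i + s) (c + s) v ≈ extend a c v + s
  lo-shift s a c ‵fromℕ       = ≈-refl
  lo-shift s a c (‵inject₁ _) = ≈-refl

  hi-shift : ∀ s a c {j} (v : View j) →
             extend (λ i → a i + s + 1#) (c + s) v ≈ extend (λ i → a i + 1#) c v + s
  hi-shift s a c ‵fromℕ       = ≈-refl
  hi-shift s a c (‵inject₁ i) = ≈-trans (+-assoc (a i) s 1#)
    (≈-trans (+-congˡ (+-comm s 1#)) (≈-sym (+-assoc (a i) 1# s)))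

-- Counting cubes and comparing the two minima

total≤1 : ∀ {k} (s : Fin k → ℕ) → (∀ (x y : Σ (Fin k) (Fin ∘ s)) → x ≡ y) → total s ℕ.≤ 1
total≤1 s unique = ≤1 λ i j → Injection.injective (↔⇒↣ (↔-sym (flatten s))) (unique _ _)
  where
  ≤1 : ∀ {n} → (∀ (i j : Fin n) → i ≡ j) → n ℕ.≤ 1
  ≤1 {zero}        _  = z≤n
  ≤1 {suc zero}    _  = s≤s z≤n
  ≤1 {suc (suc n)} eq with () ← eq zero (suc zero)

total≤k : ∀ {k} (s : Fin k → ℕ) → (∀ i → s i ℕ.≤ 1) → total s ℕ.≤ k
total≤k {zero}  s s≤1 = z≤n
total≤k {suc k} s s≤1 = ℕ.+-mono-≤ (s≤1 zero) (total≤k (s ∘ suc) (s≤1 ∘ suc))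

module _ {R : Reals} {M : Model R} (B : BoxModel M) {N : ℕ} where

  -- The trees of a forest share no vertex, so a vertex receives cubes from at most one tree, and
  -- there it has just one.
  forest-representation : {F : Graph N} → IsVisibilityForest M F → Representable M F 1
  forest-representation (k , H , trees , vertexDisjoint , union) =
    U.representation , λ v → total≤1 (λ i → U.ρ.size i v) (unique v)
    where
    ρ = λ i → proj₁ (proj₂ (trees i))
    module U = UnionRepresentation B H ρ union
    occupied : ∀ {v} i → Fin (U.ρ.size i v) → v ∈ˢ Graph.vertices (H i)
    occupied i a = Equivalence.from (U.ρ.assigned i _) (ℕ.≤-<-trans z≤n (Fin.toℕ<n a))
    single : ∀ {n} → n ≡ 1 → (a b : Fin n) → a ≡ b
    single refl zero zero = refl
    unique : ∀ v (x y : Σ (Fin k) λ i → Fin (U.ρ.size i v)) → x ≡ y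
    unique v (i , a) (j , b) with i ≟ j
    ... | yes refl = cong (i ,_) (single (proj₂ (proj₂ (trees i)) v (occupied i a)) a b)
    ... | no  i≢j  = contradiction (occupied j b) (vertexDisjoint i j i≢j v (occupied i a))

  -- The union construction is applied a second time, now to forests that may share vertices. Cubes
  -- of one vertex from different forests lie in different pieces and do not see each other, and
  -- each forest adds at most one.
  decomposable⇒representable : ∀ {T : Graph N} {k} → ForestDecomposable M T k → Representable M T k
  decomposable⇒representable (F , forests , union) =
    UnionRepresentation.representation B F (proj₁ ∘ represented) union ,
    λ v → total≤k _ λ i → proj₂ (represented i) v
    where
    represented : ∀ i → Representable M (F i) 1
    represented i = forest-representation (forests i)

-- Equivalence at every `k` also settles the value `⊤⁺`: one minimum is infinite only if the other
-- is.
min-cong : (em : ExcludedMiddle 0ℓ) {P Q : ℕ → Set} → (∀ k → P k ⇔ Q k) → min em P ≡ min em Q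
min-cong em {P} {Q} P⇔Q with minimum em P | minimum em Q
... | [ k ] , pk , k≤ | [ l ] , ql , l≤ =
  cong [_] (ℕ.≤-antisym (k≤ l (Equivalence.from (P⇔Q l) ql)) (l≤ k (Equivalence.to (P⇔Q k) pk)))
... | [ k ] , pk , _ | ⊤⁺ , ¬Q = contradiction (Equivalence.to (P⇔Q k) pk) (¬Q k)
... | ⊤⁺ , ¬P | [ l ] , ql , _ = contradiction (Equivalence.from (P⇔Q l) ql) (¬P l)
... | ⊤⁺ , _ | ⊤⁺ , _ = refl

arboricity≡visibilityNumber : (em : ExcludedMiddle 0ℓ) {R : Reals} {M : Model R} → BoxModel M →
  ∀ {N} (T : Graph N) → IsTree T → arboricity M em T ≡ visibilityNumber M em T
arboricity≡visibilityNumber em B T tree = min-cong em λ k → mk⇔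
  (decomposable⇒representable B)
  (λ (ρ , size≤k) → Decomposition.decomposable em B T tree ρ size≤k)

open import Data.Nat.Base using (_≤_)

theorem2 : (em : ExcludedMiddle 0ℓ) (R : Reals) (n : ℕ) → 1 ≤ n →
    ∀ {N : ℕ} (T : Graph N) → IsTree T →
    (arboricity (standard R n) em T ≡ visibilityNumber (standard R n) em T) ×
    (arboricity (orthogonal R n) em T ≡ visibilityNumber (orthogonal R n) em T)
theorem2 em R (suc n) _ T tree =
  arboricity≡visibilityNumber em (standardBoxes R n) T tree ,
  arboricity≡visibilityNumber em (orthogonalBoxes R (suc n)) T tree
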